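{- Let $\mathcal{C}$ be a $d$-clutter on vertex set $[n]$, let $\mathbb{K}$ be a field, and let $I_{\overline{\mathcal{C}}} \subset R=\mathbb{K}[x_1,\dots,x_n]$ be the circuit ideal of the complement of $\mathcal{C}$. Then $\mathcal{C}$ can be obtained from the complete $d$-clutter $K_n^d$ through a (possibly empty) sequence of circuit erasures if and only if $I_{\overline{\mathcal{C}}}$ has linear quotients and $$\operatorname{pdim}(I_{\overline{\mathcal{C}}}) < n-d.$$
   Context: A $d$-clutter ($d\ge 1$) on $[n]=\{1,\dots,n\}$ is a collection $\mathcal{C}$ of $d$-element subsets of $[n]$, called circuits. The complete $d$-clutter $K_n^d$ consists of all $d$-subsets of $[n]$. The complement $\overline{\mathcal{C}}$ consists of all $d$-subsets of $[n]$ not in $\mathcal{C}$. A clique of $\mathcal{C}$ is a nonempty $S \subset [n]$ such that either $|S|<d$, or $|S|\ge d$ and every $d$-subset of $S$ is a circuit of $\mathcal{C}$; it is maximal if it is maximal under inclusion among cliques. A circuit $e\in\mathcal{C}$ is exposed if it is contained in a unique maximal clique $S$ of $\mathcal{C}$, and properly exposed if moreover $|S|>d$. A circuit erasure is the removal of a properly exposed circuit $e$, i.e. passing from $\mathcal{C}$ to $\mathcal{C}\setminus\{e\}$. For $e=\{v_1,\dots,v_d\}$, $\mathbf{x}_e = x_{v_1}\cdots x_{v_d}$, and the circuit ideal of a $d$-clutter $\mathcal{D}$ is $I_{\mathcal{D}} = \langle \mathbf{x}_f : f\in\mathcal{D}\rangle$. A monomial ideal $I$ has linear quotients if there is an ordering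 $(m_1,\dots,m_g)$ of its minimal monomial generators such that for every $j=1,\dots,g-1$ the colon ideal $(\langle m_1,\dots,m_j\rangle : m_{j+1})$ is generated by a subset of the variables (the zero ideal has linear quotients vacuously). The projective dimension of a graded ideal $I$, regarded as an $R$-module, is $\operatorname{pdim}(I)=\max\{i : \beta_i(I)\ne 0\}$, where $\beta_i(I)=\dim_{\mathbb{K}}\operatorname{Tor}_i^R(I,\mathbb{K})$; by convention $\operatorname{pdim}(0)=-\infty$. -}

module Defs where

open import Algebra.Apartness.Bundles using (HeytingField; HeytingCommutativeRing)
open import Algebra.Bundles using (CommutativeRing)
open import Algebra.Bundles.Raw using (RawRing)
import Algebra.Definitions.RawMonoid as RawMonoidDefinitions
open import Data.Bool.Base using (if_then_else_)
open import Data.Fin.Base using (Fin; zero; suc; toℕ)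
open import Data.Fin.Subset using (Subset; Nonempty; _∈_; _⊆_; ∣_∣; ⁅_⁆)
open import Data.Integer.Base as ℤ using (ℤ; +_)
open import Data.List.Base as List using (List; []; _∷_; _++_)
open import Data.List.Membership.Propositional renaming (_∈_ to _∈ᴸ_)
open import Data.List.Relation.Unary.Unique.Propositional using (Unique)
open import Data.Nat.Base using (ℕ; zero; suc; _+_; _≤_; _<_)
import Data.Nat.Properties as ℕ
open import Data.Product.Base using (Σ; ∃; ∃-syntax; _×_; _,_; proj₁)
open import Data.Sum.Base using (_⊎_)
open import Data.Unit.Polymorphic.Base using (⊤)
open import Data.Vec.Base as Vec using (Vec)
open import Data.Vec.Functional using (Vector)
import Data.Vec.Properties as Vec
open import Data.Vec.Relation.Binary.Pointwise.Inductive using (Pointwise)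
open import Function.Bundles using (_⇔_)
open import Level using (Level; 0ℓ; _⊔_)
open import Relation.Binary.Construct.Closure.ReflexiveTransitive using (Star)
open import Relation.Binary.PropositionalEquality using (_≡_; _≢_)
open import Relation.Nullary using (¬_; does; ¬?; _×-dec_)
open import Relation.Nullary.Construct.Add.Infimum using (_₋; ⊥₋; [_])
open import Relation.Unary using (Pred; Decidable; _≐_)

------------------------------------------------------------------------
-- Clutters

-- Membership is required to be decidable, as it is for any subset of a
-- finite set classically.  Two clutters are the same when their
-- `Circuit` predicates are extensionally equal (`_≐_`).
record Clutter (d n : ℕ) : Set₁ where
  field
    Circuit  : Pred (Subset n) 0ℓ
    circuit? : Decidable Circuit
    uniform  : ∀ {e} → Circuit e → ∣ e ∣ ≡ d

open Clutter public

module _ {d n : ℕ} where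

  complete : Clutter d n
  complete .Circuit e = ∣ e ∣ ≡ d
  complete .circuit? e = ∣ e ∣ ℕ.≟ d
  complete .uniform ∣e∣≡d = ∣e∣≡d

  complement : Clutter d n → Clutter d n
  complement C .Circuit e = ∣ e ∣ ≡ d × ¬ Circuit C e
  complement C .circuit? e = (∣ e ∣ ℕ.≟ d) ×-dec ¬? (circuit? C e)
  complement C .uniform = proj₁

  Clique : Clutter d n → Pred (Subset n) 0ℓ
  Clique C S = Nonempty S ×
    (∣ S ∣ < d ⊎ (d ≤ ∣ S ∣ × (∀ e → ∣ e ∣ ≡ d → e ⊆ S → Circuit C e)))

  MaximalClique : Clutter d n → Pred (Subset n) 0ℓ
  MaximalClique C S = Clique C S × (∀ T → Clique C T → S ⊆ T → T ≡ S)

  -- e is exposed, S being the unique maximal clique that contains it.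
  ExposedIn : Clutter d n → Subset n → Subset n → Set
  ExposedIn C S e = Circuit C e × MaximalClique C S × e ⊆ S ×
    (∀ T → MaximalClique C T → e ⊆ T → T ≡ S)

  ProperlyExposed : Clutter d n → Pred (Subset n) 0ℓ
  ProperlyExposed C e = ∃[ S ] ExposedIn C S e × d < ∣ S ∣

  Erasure : Clutter d n → Clutter d n → Set
  Erasure C D = ∃[ e ] ProperlyExposed C e ×
    Circuit D ≐ (λ f → Circuit C f × f ≢ e)

  -- The final `_≐_` matters only for the empty sequence of erasures, since
  -- `Erasure` already determines its target only up to `_≐_`.
  ObtainedByErasures : Pred (Clutter d n) _
  ObtainedByErasures C = ∃[ D ] Star Erasure complete D × Circuit D ≐ Circuit C

------------------------------------------------------------------------
-- Finite free modules A ^ m over a ring A and matrices acting on them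

module LinearAlgebra {a ℓ} (A : RawRing a ℓ) where
  open RawRing A
  open RawMonoidDefinitions +-rawMonoid public using (sum)

  infix  4 _≋_
  infixl 7 _·_

  _≋_ : ∀ {m} → Vector Carrier m → Vector Carrier m → Set ℓ
  u ≋ v = ∀ i → u i ≈ v i

  0ᵛ : ∀ {m} → Vector Carrier m
  0ᵛ _ = 0#

  -- Rows × columns.
  Matrix : ℕ → ℕ → Set a
  Matrix r c = Vector (Vector Carrier c) r

  dot : ∀ {m} → Vector Carrier m → Vector Carrier m → Carrier
  dot u v = sum (λ i → u i * v i)

  _·_ : ∀ {r c} → Matrix r c → Vector Carrier c → Vector Carrier r
  (M · v) i = dot (M i) v

module OverField {c ℓ₁ ℓ₂} (K : HeytingField c ℓ₁ ℓ₂) where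

  coefficientRing : RawRing c ℓ₁
  coefficientRing =
    CommutativeRing.rawRing
      (HeytingCommutativeRing.commutativeRing
        (HeytingField.heytingCommutativeRing K))

  private
    module K = RawRing coefficientRing
    module Kᵐ = LinearAlgebra coefficientRing

  ----------------------------------------------------------------------
  -- The polynomial ring R = K[x₁,…,xₙ]

  module Polynomials (n : ℕ) where

    -- Exponent vectors.
    Monomial : Set
    Monomial = Vec ℕ n

    1ᵐ : Monomial
    1ᵐ = Vec.replicate n 0

    _*ᵐ_ : Monomial → Monomial → Monomial
    _*ᵐ_ = Vec.zipWith _+_

    _∣ᵐ_ : Monomial → Monomial → Set
    _∣ᵐ_ = Pointwise _≤_

    -- A formal sum of terms, in any order and possibly with repeated
    -- monomials or zero coefficients; equality compares coefficients.
    Poly : Set c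
    Poly = List (K.Carrier × Monomial)

    coeff : Poly → Monomial → K.Carrier
    coeff []            m = K.0#
    coeff ((a , k) ∷ p) m =
      if does (Vec.≡-dec ℕ._≟_ k m) then a K.+ coeff p m else coeff p m

    polynomialRing : RawRing c ℓ₁
    polynomialRing = record
      { Carrier = Poly
      ; _≈_     = λ p q → ∀ m → coeff p m K.≈ coeff q m
      ; _+_     = _++_
      ; _*_     = List.cartesianProductWith
                    (λ (a , k) (b , l) → a K.* b , k *ᵐ l)
      ; -_      = List.map (λ (a , k) → K.- a , k)
      ; 0#      = []
      ; 1#      = (K.1# , 1ᵐ) ∷ []
      }

    private
      module R = RawRing polynomialRing
      module Rᵐ = LinearAlgebra polynomialRing

    monomial : Monomial → Poly
    monomial m = (K.1# , m) ∷ []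

    -- 𝐱_S, the product of the variables indexed by S.
    𝐱 : Subset n → Monomial
    𝐱 S = Vec.map (λ s → if s then 1 else 0) S

    variable′ : Fin n → Poly
    variable′ i = monomial (𝐱 ⁅ i ⁆)

    ----------------------------------------------------------------------
    -- Ideals, as predicates on R

    Ideal : Set _
    Ideal = Pred Poly (c ⊔ ℓ₁)

    -- The ideal generated by a family: the R-linear combinations of
    -- finitely many of its members.
    ⟨_⟩ : {J : Set} → (J → Poly) → Ideal
    ⟨_⟩ {J} g f = ∃[ k ] Σ (Vector Poly k) λ h → Σ (Vector J k) λ j →
      f R.≈ Rᵐ.sum (λ i → h i R.* g (j i))

    monomialIdeal : List Monomial → Ideal
    monomialIdeal ms = ⟨ (λ i → monomial (List.lookup ms i)) ⟩

    circuitIdeal : ∀ {d} → Clutter d n → Ideal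
    circuitIdeal D = ⟨ (λ ((f , _) : ∃ (Circuit D)) → monomial (𝐱 f)) ⟩

    colon : Ideal → Poly → Ideal
    colon I g f = I (f R.* g)

    GeneratedByVariables : Ideal → Set _
    GeneratedByVariables I = ∃[ A ]
      I ≐ ⟨ (λ ((i , _) : ∃ (_∈ A)) → variable′ i) ⟩

    record MinimalMonomialGenerators (I : Ideal) (ms : List Monomial)
           : Set (c ⊔ ℓ₁) where
      field
        generate : I ≐ monomialIdeal ms
        minimal  : ∀ {m} → m ∈ᴸ ms → ∀ k → I (monomial k) → k ∣ᵐ m → k ≡ m
        distinct : Unique ms

    -- `List.lookup ms j` is the generator m_{j+1} of the 1-based
    -- enumeration m₁,…,m_g, and `List.take (toℕ j) ms` is m₁,…,m_j.
    HasLinearQuotients : Ideal → Set _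
    HasLinearQuotients I = ∃[ ms ] MinimalMonomialGenerators I ms ×
      (∀ (j : Fin (List.length ms)) → 1 ≤ toℕ j →
        GeneratedByVariables
          (colon (monomialIdeal (List.take (toℕ j) ms))
                 (monomial (List.lookup ms j))))

    ----------------------------------------------------------------------
    -- Tor, Betti numbers and projective dimension

    -- An exact sequence  ⋯ → R ^ rank 1 → R ^ rank 0 → I → 0,  by finitely
    -- generated free modules.  The augmentation is given by the images of
    -- the standard basis.
    record FreeResolution (I : Ideal) : Set (c ⊔ ℓ₁) where
      field
        rank   : ℕ → ℕ
        ε      : Vector Poly (rank 0)
        ∂      : ∀ i → Rᵐ.Matrix (rank i) (rank (suc i))
        onto   : I ≐ (λ f → ∃[ v ] f R.≈ Rᵐ.dot ε v)
        exact₀ : ∀ v → Rᵐ.dot ε v R.≈ R.0# ⇔ (∃[ w ] v Rᵐ.≋ ∂ 0 Rᵐ.· w)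
        exact  : ∀ i v →
          ∂ i Rᵐ.· v Rᵐ.≋ Rᵐ.0ᵛ ⇔ (∃[ w ] v Rᵐ.≋ ∂ (suc i) Rᵐ.· w)

    -- Torᵢ(I, K) is the homology at F i ⊗ K of the complex F ⊗ K, where
    -- R ^ m ⊗ K is identified with K ^ m.  R acts on K = R / (x₁,…,xₙ)
    -- through the constant term, so ∂ i ⊗ K is the matrix of constant
    -- terms of ∂ i.
    module Tor {I : Ideal} (F : FreeResolution I) where
      open FreeResolution F

      ∂⊗K : ∀ i → Kᵐ.Matrix (rank i) (rank (suc i))
      ∂⊗K i r s = coeff (∂ i r s) 1ᵐ

      Cycle : ∀ i → Pred (Vector K.Carrier (rank i)) ℓ₁
      Cycle zero    z = ⊤
      Cycle (suc i) z = ∂⊗K i Kᵐ.· z Kᵐ.≋ Kᵐ.0ᵛ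

      Boundary : ∀ i → Pred (Vector K.Carrier (rank i)) (c ⊔ ℓ₁)
      Boundary i z = ∃[ w ] z Kᵐ.≋ ∂⊗K i Kᵐ.· w

      combination : ∀ {m b} → Vector K.Carrier b →
                    Vector (Vector K.Carrier m) b → Vector K.Carrier m
      combination a z r = Kᵐ.sum (λ k → a k K.* z k r)

      -- A family of cycles whose classes form a K-basis of
      -- Cycle i / Boundary i.
      record IsBasis i {b : ℕ} (z : Vector (Vector K.Carrier (rank i)) b)
             : Set (c ⊔ ℓ₁) where
        field
          cycles      : ∀ k → Cycle i (z k)
          independent : ∀ a → Boundary i (combination a z) → a Kᵐ.≋ Kᵐ.0ᵛ
          spanning    : ∀ y → Cycle i y →
            ∃[ a ] Boundary i (λ r → y r K.+ K.- combination a z r)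

    -- βᵢ(I) = b.  The choice of F is immaterial.
    Betti : Ideal → ℕ → ℕ → Set _
    Betti I i b = Σ (FreeResolution I) λ F → ∃ (Tor.IsBasis F i {b})

    BettiNonzero : Ideal → ℕ → Set _
    BettiNonzero I i = ∃[ b ] Betti I i b × b ≢ 0

    -- pdim I = p, where ⊥₋ stands for -∞.
    data IsPdim (I : Ideal) : ℤ ₋ → Set (c ⊔ ℓ₁) where
      pdim-zero : (∀ f → I f → f R.≈ R.0#) → IsPdim I ⊥₋
      pdim-max  : ∀ i → BettiNonzero I i →
                  (∀ j → BettiNonzero I j → j ≤ i) → IsPdim I [ + i ]

{-# OPTIONS --safe #-}
module Submission where

-- A circuit e is properly exposed in 𝒞, with maximal clique S, exactly when the colon ideal of
-- I = ⟨𝐱_f : f ∉ 𝒞⟩ by 𝐱_e is generated by the variables outside S and |S| > d. Hence a sequence of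
-- erasures is the same as an order of linear quotients for I in which every colon ideal is generated
-- by fewer than n - d variables. Adding one generator with colon ideal (A) to an ideal replaces its
-- resolution by the mapping cone of a lift of multiplication by the generator, defined on the Koszul
-- complex on A. The generators all have degree d, so the lift can be taken linear and the cone is a
-- minimal resolution, whose length is the largest |A|. So pdim I is the largest of these sizes.

-- `Betti` lets the free resolution vary. One minimal resolution therefore shows which Betti numbers
-- are nonzero, but not which vanish: a basis of Tor computed from any other resolution must be
-- shown to be empty as well. This is done by a contraction. Comparison with a resolution of rank 0
-- in some degree makes the identity null-homotopic in that degree, and on constant terms this turns
-- every cycle into a boundary. Minimality of the cone is read off from degrees. With basis vectors
-- in degree 0 and all differentials after the augmentation linear, no matrix entry has a constant
-- term, so each rank is a Betti number. The ranks are sums of binomial coefficients and cannot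
-- cancel, so the rank in degree i is nonzero exactly when some colon ideal needs at least i
-- variables.

open import Defs
open import Algebra.Apartness.Bundles using (HeytingField; HeytingCommutativeRing)
open import Algebra.Bundles using (CommutativeRing)
open import Algebra.Bundles.Raw using (RawRing)
import Algebra.Properties.CommutativeSemigroup as CommutativeSemigroupProperties
import Algebra.Properties.Ring as RingProperties
import Algebra.Properties.Semiring.Sum as SemiringSum
open import Data.Bool.Base using (true; false; if_then_else_)
import Data.Bool.Properties as Bool
open import Data.Empty using (⊥-elim)
open import Data.Fin.Base using (Fin; zero; suc; toℕ; splitAt; join; _↑ˡ_; _↑ʳ_)
import Data.Fin.Properties as Fin
open import Data.Fin.Subset using (Subset; inside; outside; _∈_; _∉_; _⊆_; _⊃_; _∪_; _─_; _-_; ∁; ⊥; ∣_∣; ⁅_⁆; Nonempty)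
open import Data.Fin.Subset.Induction using (⊃-wellFounded)
open import Data.Fin.Subset.Properties
import Data.Integer.Base as ℤ
import Data.Integer.Properties as ℤ
open import Data.List.Base as List using (List; []; _∷_; _++_; _∷ʳ_; length; take)
open import Data.List.Membership.Propositional using (lose; find) renaming (_∈_ to _∈ᴸ_)
open import Data.List.Membership.Propositional.Properties using (∈-++⁺ˡ; ∈-++⁺ʳ; ∈-++⁻; ∈-lookup; ∈-map⁺; ∈-map⁻)
open import Data.List.Properties using (++-assoc; ++-identityʳ; ∷ʳ-++)
open import Data.List.Relation.Unary.All using ([])
open import Data.List.Relation.Unary.AllPairs using ([]; _∷_)
open import Data.List.Relation.Unary.Any as Any using (Any; here; there; any?)
import Data.List.Relation.Unary.Any.Properties as Any
open import Data.List.Relation.Unary.Unique.Propositional using (Unique)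
import Data.List.Relation.Unary.Unique.Propositional.Properties as Unique
open import Data.Nat.Base using (ℕ; zero; suc; _+_; _∸_; _≤_; _<_; z≤n; s≤s)
import Data.Nat.Properties as ℕ
open import Data.Product.Base using (Σ; ∃; ∃-syntax; _×_; _,_; proj₁; proj₂)
open import Data.Sum.Base as Sum using (_⊎_; inj₁; inj₂; [_,_]′)
open import Data.Unit.Polymorphic.Base using (tt)
open import Data.Vec.Base as Vec using (Vec; []; _∷_; here; there)
import Data.Vec.Functional as Functional
open import Data.Vec.Functional using (Vector)
import Data.Vec.Properties as Vec
open import Data.Vec.Relation.Binary.Pointwise.Inductive as Pointwise using (Pointwise; []; _∷_)
open import Function.Base using (_∘_; id)
open import Function.Bundles using (_⇔_; mk⇔; Equivalence)
open import Induction.WellFounded using (Acc; acc)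
open import Level using (_⊔_)
open import Relation.Binary.Construct.Add.Infimum.Strict ℤ._<_ using (_<₋_; [_]; ⊥₋<[_])
open import Relation.Binary.Construct.Closure.ReflexiveTransitive using (Star; _◅_)
open import Relation.Binary.PropositionalEquality as ≡ using (_≡_; _≢_)
import Relation.Binary.Reasoning.Setoid as SetoidReasoning
open import Relation.Nullary using (Dec; yes; no; does; ¬_; ¬?; _×-dec_; _⊎-dec_)
open import Relation.Nullary.Construct.Add.Infimum using (⊥₋; [_])
open import Relation.Nullary.Decidable using (map′; decidable-stable; dec-true; dec-false)
open import Relation.Unary using (Pred; Decidable; _≐_)

-- Linear maps of free modules, acyclic complexes and mapping cones

-- The ranks of R ← F₀ ← F₁ ← ⋯, given those of the Fᵢ.
aug : (ℕ → ℕ) → ℕ → ℕ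
aug r zero    = 1
aug r (suc i) = r i

module LinearMaps {a ℓ} (R : CommutativeRing a ℓ) where
  open CommutativeRing R hiding (zero) renaming (_+_ to _+ᴿ_)
  open RingProperties ring using (-‿distribʳ-*; -‿involutive; -0#≈0#; -‿+-comm; -1*x≈-x)
  open LinearAlgebra rawRing
  open SetoidReasoning setoid

  private
    module FiniteSum = SemiringSum semiring

  sum-cong : ∀ {m} {u v : Vector Carrier m} → u ≋ v → sum u ≈ sum v
  sum-cong {m} {u} {v} = FiniteSum.sum-cong-≋ {m} {u} {v}

  sum-+ : ∀ {m} (u v : Vector Carrier m) → sum (λ i → u i +ᴿ v i) ≈ sum u +ᴿ sum v
  sum-+ {m} u v = FiniteSum.∑-distrib-+ {m} u v

  *-sum : ∀ {m} x (v : Vector Carrier m) → x * sum v ≈ sum (λ i → x * v i)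
  *-sum {m} x v = FiniteSum.*-distribˡ-sum {m} x v

  infixl 6 _⊞_
  infixl 7 _∙_

  _⊞_ : ∀ {m} → Vector Carrier m → Vector Carrier m → Vector Carrier m
  (u ⊞ v) i = u i +ᴿ v i

  ⊟_ : ∀ {m} → Vector Carrier m → Vector Carrier m
  (⊟ v) i = - v i

  _∙_ : ∀ {m} → Carrier → Vector Carrier m → Vector Carrier m
  (x ∙ v) i = x * v i

  ≋-trans : ∀ {m} {u v w : Vector Carrier m} → u ≋ v → v ≋ w → u ≋ w
  ≋-trans p q i = trans (p i) (q i)

  ≋-sym : ∀ {m} {u v : Vector Carrier m} → u ≋ v → v ≋ u
  ≋-sym p i = sym (p i)

  basis : ∀ {m} → Fin m → Vector Carrier m
  basis zero    zero    = 1#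
  basis zero    (suc i) = 0#
  basis (suc s) zero    = 0#
  basis (suc s) (suc i) = basis s i

  basis-sym : ∀ {m} (s i : Fin m) → basis s i ≡ basis i s
  basis-sym zero    zero    = ≡.refl
  basis-sym zero    (suc i) = ≡.refl
  basis-sym (suc s) zero    = ≡.refl
  basis-sym (suc s) (suc i) = basis-sym s i

  sum-zero : ∀ {m} (v : Vector Carrier m) → v ≋ 0ᵛ → sum v ≈ 0#
  sum-zero {zero}  v v≋0 = refl
  sum-zero {suc m} v v≋0 =
    trans (+-cong (v≋0 zero) (sum-zero (λ i → v (suc i)) (λ i → v≋0 (suc i)))) (+-identityˡ 0#)

  sum-basis : ∀ {m} (v : Vector Carrier m) i → sum (λ s → v s * basis s i) ≈ v i
  sum-basis {suc m} v zero = begin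
    v zero * 1# +ᴿ sum (λ s → v (suc s) * 0#)
      ≈⟨ +-cong (*-identityʳ _) (sum-zero {m} _ (λ s → zeroʳ _)) ⟩
    v zero +ᴿ 0#  ≈⟨ +-identityʳ _ ⟩
    v zero        ∎
  sum-basis {suc m} v (suc i) = begin
    v zero * 0# +ᴿ sum (λ s → v (suc s) * basis s i)
      ≈⟨ +-cong (zeroʳ _) (sum-basis (λ s → v (suc s)) i) ⟩
    0# +ᴿ v (suc i)  ≈⟨ +-identityˡ _ ⟩
    v (suc i)        ∎

  sum-basisˡ : ∀ {m} (v : Vector Carrier m) i → sum (λ s → basis i s * v s) ≈ v i
  sum-basisˡ v i = trans
    (sum-cong (λ s → trans (*-comm _ _) (reflexive (≡.cong (v s *_) (basis-sym i s)))))
    (sum-basis v i)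

  infix 4 _⊸_

  -- Maps are functions that respect `_≋_`, so that composites need no matrix products. `fromMatrix`
  -- and `toMatrix` translate from and to the matrices of a `FreeResolution`.
  record _⊸_ (m r : ℕ) : Set (a ⊔ ℓ) where
    field
      fn     : Vector Carrier m → Vector Carrier r
      cong   : ∀ {u v} → u ≋ v → fn u ≋ fn v
      +-homo : ∀ u v → fn (u ⊞ v) ≋ fn u ⊞ fn v
      ∙-homo : ∀ x v → fn (x ∙ v) ≋ x ∙ fn v

    0-homo : fn 0ᵛ ≋ 0ᵛ
    0-homo i = begin
      fn 0ᵛ i         ≈⟨ cong (λ j → sym (zeroˡ 0#)) i ⟩
      fn (0# ∙ 0ᵛ) i  ≈⟨ ∙-homo 0# 0ᵛ i ⟩
      0# * fn 0ᵛ i    ≈⟨ zeroˡ _ ⟩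
      0#              ∎

    ⊟-homo : ∀ v → fn (⊟ v) ≋ ⊟ fn v
    ⊟-homo v i = begin
      fn (⊟ v) i         ≈⟨ cong (λ j → sym (-1*x≈-x (v j))) i ⟩
      fn (- 1# ∙ v) i    ≈⟨ ∙-homo (- 1#) v i ⟩
      - 1# * fn v i      ≈⟨ -1*x≈-x _ ⟩
      - fn v i           ∎

    sum-homo : ∀ {k} (w : Fin k → Vector Carrier m) →
               fn (λ i → sum (λ s → w s i)) ≋ λ i → sum (λ s → fn (w s) i)
    sum-homo {zero}  w i = 0-homo i
    sum-homo {suc k} w i = trans (+-homo _ _ i) (+-congˡ (sum-homo (λ s → w (suc s)) i))

    expand : ∀ v → fn v ≋ λ i → sum (λ s → v s * fn (basis s) i)
    expand v i = begin
      fn v i                                    ≈⟨ cong (λ j → sym (sum-basis v j)) i ⟩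
      fn (λ j → sum (λ s → (v s ∙ basis s) j)) i  ≈⟨ sum-homo (λ s → v s ∙ basis s) i ⟩
      sum (λ s → fn (v s ∙ basis s) i)          ≈⟨ sum-cong (λ s → ∙-homo (v s) (basis s) i) ⟩
      sum (λ s → v s * fn (basis s) i)          ∎

  open _⊸_ public using (fn)
  open _⊸_

  module _ {m r} (f g : m ⊸ r) where
    ext : (∀ s → fn f (basis s) ≋ fn g (basis s)) → ∀ v → fn f v ≋ fn g v
    ext f≋g v i = begin
      fn f v i                              ≈⟨ expand f v i ⟩
      sum (λ s → v s * fn f (basis s) i)    ≈⟨ sum-cong (λ s → *-congˡ (f≋g s i)) ⟩
      sum (λ s → v s * fn g (basis s) i)    ≈⟨ expand g v i ⟨
      fn g v i                              ∎

  lin : ∀ {m r} → (Fin m → Vector Carrier r) → m ⊸ r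
  lin w .fn v i = sum (λ s → v s * w s i)
  lin w .cong u≋v i = sum-cong (λ s → *-congʳ {w s i} (u≋v s))
  lin w .+-homo u v i = trans
    (sum-cong (λ s → distribʳ (w s i) (u s) (v s)))
    (sum-+ (λ s → u s * w s i) (λ s → v s * w s i))
  lin w .∙-homo x v i = trans
    (sum-cong (λ s → *-assoc x (v s) (w s i)))
    (sym (*-sum x (λ s → v s * w s i)))

  lin-basis : ∀ {m r} (w : Fin m → Vector Carrier r) s → fn (lin w) (basis s) ≋ w s
  lin-basis w s i = sum-basisˡ (λ t → w t i) s

  fromMatrix : ∀ {m r} → Matrix r m → m ⊸ r
  fromMatrix M .fn v = M · v
  fromMatrix M .cong u≋v i = sum-cong (λ s → *-congˡ {M i s} (u≋v s))
  fromMatrix M .+-homo u v i = trans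
    (sum-cong (λ s → distribˡ (M i s) (u s) (v s)))
    (sum-+ (λ s → M i s * u s) (λ s → M i s * v s))
  fromMatrix M .∙-homo x v i = trans
    (sum-cong (λ s → trans (sym (*-assoc (M i s) x (v s)))
      (trans (*-congʳ (*-comm (M i s) x)) (*-assoc x (M i s) (v s)))))
    (sym (*-sum x (λ s → M i s * v s)))

  toMatrix : ∀ {m r} → m ⊸ r → Matrix r m
  toMatrix f i s = fn f (basis s) i

  toMatrix-· : ∀ {m r} (f : m ⊸ r) v → fn f v ≋ toMatrix f · v
  toMatrix-· f v i =
    trans (expand f v i) (sum-cong (λ s → *-comm (v s) (fn f (basis s) i)))

  idₗ : ∀ {m} → m ⊸ m
  idₗ .fn v = v
  idₗ .cong u≋v = u≋v
  idₗ .+-homo u v i = refl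
  idₗ .∙-homo x v i = refl

  0ₗ : ∀ {m r} → m ⊸ r
  0ₗ .fn v = 0ᵛ
  0ₗ .cong u≋v i = refl
  0ₗ .+-homo u v i = sym (+-identityˡ 0#)
  0ₗ .∙-homo x v i = sym (zeroʳ x)

  infixr 9 _∘ₗ_
  infixl 6 _+ₗ_

  _∘ₗ_ : ∀ {k m r} → m ⊸ r → k ⊸ m → k ⊸ r
  (g ∘ₗ f) .fn v = fn g (fn f v)
  (g ∘ₗ f) .cong u≋v = cong g (cong f u≋v)
  (g ∘ₗ f) .+-homo u v = ≋-trans (cong g (+-homo f u v)) (+-homo g _ _)
  (g ∘ₗ f) .∙-homo x v = ≋-trans (cong g (∙-homo f x v)) (∙-homo g x _)

  interchange : ∀ w x y z → (w +ᴿ x) +ᴿ (y +ᴿ z) ≈ (w +ᴿ y) +ᴿ (x +ᴿ z)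
  interchange w x y z = begin
    (w +ᴿ x) +ᴿ (y +ᴿ z)  ≈⟨ +-assoc w x _ ⟩
    w +ᴿ (x +ᴿ (y +ᴿ z))  ≈⟨ +-congˡ (+-assoc x y z) ⟨
    w +ᴿ ((x +ᴿ y) +ᴿ z)  ≈⟨ +-congˡ (+-congʳ (+-comm x y)) ⟩
    w +ᴿ ((y +ᴿ x) +ᴿ z)  ≈⟨ +-congˡ (+-assoc y x z) ⟩
    w +ᴿ (y +ᴿ (x +ᴿ z))  ≈⟨ +-assoc w y _ ⟨
    (w +ᴿ y) +ᴿ (x +ᴿ z)  ∎

  _+ₗ_ : ∀ {m r} → m ⊸ r → m ⊸ r → m ⊸ r
  (f +ₗ g) .fn v = fn f v ⊞ fn g v
  (f +ₗ g) .cong u≋v i = +-cong (cong f u≋v i) (cong g u≋v i)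
  (f +ₗ g) .+-homo u v i =
    trans (+-cong (+-homo f u v i) (+-homo g u v i)) (interchange _ _ _ _)
  (f +ₗ g) .∙-homo x v i =
    trans (+-cong (∙-homo f x v i) (∙-homo g x v i)) (sym (distribˡ x _ _))

  -ₗ_ : ∀ {m r} → m ⊸ r → m ⊸ r
  (-ₗ f) .fn v = ⊟ fn f v
  (-ₗ f) .cong u≋v i = -‿cong (cong f u≋v i)
  (-ₗ f) .+-homo u v i = trans (-‿cong (+-homo f u v i)) (sym (-‿+-comm _ _))
  (-ₗ f) .∙-homo x v i = trans (-‿cong (∙-homo f x v i)) (-‿distribʳ-* x _)

  mul : Carrier → ∀ {m} → m ⊸ m
  mul x .fn v = x ∙ v
  mul x .cong u≋v i = *-congˡ (u≋v i)
  mul x .+-homo u v i = distribˡ x _ _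
  mul x .∙-homo y v i = trans (sym (*-assoc x y _)) (trans (*-congʳ (*-comm x y)) (*-assoc y x _))

  reindex : ∀ {m r} → (Fin r → Fin m) → m ⊸ r
  reindex ρ .fn v i = v (ρ i)
  reindex ρ .cong u≋v i = u≋v (ρ i)
  reindex ρ .+-homo u v i = refl
  reindex ρ .∙-homo x v i = refl

  fstₗ : ∀ {m n} → m + n ⊸ m
  fstₗ {m} {n} = reindex (_↑ˡ n)

  sndₗ : ∀ {m n} → m + n ⊸ n
  sndₗ {m} = reindex (m ↑ʳ_)

  infixr 5 _∥_

  _∥_ : ∀ {m n} → Vector Carrier m → Vector Carrier n → Vector Carrier (m + n)
  _∥_ {m} u v i = [ u , v ]′ (splitAt m i)

  fst-∥ : ∀ {m n} (u : Vector Carrier m) (v : Vector Carrier n) → fn fstₗ (u ∥ v) ≋ u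
  fst-∥ {m} {n} u v i = reflexive (≡.cong [ u , v ]′ (Fin.splitAt-↑ˡ m i n))

  snd-∥ : ∀ {m n} (u : Vector Carrier m) (v : Vector Carrier n) → fn (sndₗ {m}) (u ∥ v) ≋ v
  snd-∥ {m} {n} u v i = reflexive (≡.cong [ u , v ]′ (Fin.splitAt-↑ʳ m n i))

  ∥-ext : ∀ {m n} {u v : Vector Carrier (m + n)} →
          fn fstₗ u ≋ fn fstₗ v → fn (sndₗ {m}) u ≋ fn sndₗ v → u ≋ v
  ∥-ext {m} {n} {u} {v} p q i = ≡.subst (λ j → u j ≈ v j) (Fin.join-splitAt m n i) (go (splitAt m i))
    where
    go : ∀ x → u (join m n x) ≈ v (join m n x)
    go (inj₁ j) = p j
    go (inj₂ j) = q j

  pairₗ : ∀ {k m n} → k ⊸ m → k ⊸ n → k ⊸ m + n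
  pairₗ f g .fn v = fn f v ∥ fn g v
  pairₗ {m = m} f g .cong u≋v i with splitAt m i
  ... | inj₁ j = cong f u≋v j
  ... | inj₂ j = cong g u≋v j
  pairₗ {m = m} f g .+-homo u v i with splitAt m i
  ... | inj₁ j = +-homo f u v j
  ... | inj₂ j = +-homo g u v j
  pairₗ {m = m} f g .∙-homo x v i with splitAt m i
  ... | inj₁ j = ∙-homo f x v j
  ... | inj₂ j = ∙-homo g x v j

  -- Free modules are projective: preimages are chosen for the basis vectors only and extended
  -- linearly, so the witnesses in `im` may depend on v in any way.
  factor : ∀ {m k r} (f : m ⊸ r) (g : k ⊸ r) → (∀ v → ∃[ w ] fn f v ≋ fn g w) →
           Σ (m ⊸ k) λ h → ∀ v → fn f v ≋ fn g (fn h v)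
  factor f g im = h , ext f (g ∘ₗ h) λ s →
      ≋-trans (proj₂ (im (basis s))) (cong g (≋-sym (lin-basis w s)))
    where
    w = λ s → proj₁ (im (basis s))
    h = lin w

  -- Indexed from the augmentation, with `d 0` landing in R ^ 1, so that one recursion covers
  -- augmentation and differentials. The homology at R ^ 1 is left free: this is a resolution of R
  -- modulo the ideal `Image`.
  record Acyclic (r : ℕ → ℕ) : Set (a ⊔ ℓ) where
    field
      d       : ∀ i → r i ⊸ aug r i
      complex : ∀ i v → fn (d i) (fn (d (suc i)) v) ≋ 0ᵛ
      exact   : ∀ i v → fn (d i) v ≋ 0ᵛ → ∃[ w ] v ≋ fn (d (suc i)) w

    Image : Carrier → Set (a ⊔ ℓ)
    Image f = ∃[ v ] (λ _ → f) ≋ fn (d 0) v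

  module ChainMap {r r′} (X : Acyclic r) (Y : Acyclic r′) (φ₀ : 1 ⊸ 1)
    (im₀ : ∀ v → ∃[ w ] fn φ₀ (fn (Acyclic.d X 0) v) ≋ fn (Acyclic.d Y 0) w) where

    private
      module X = Acyclic X
      module Y = Acyclic Y

      Step : ∀ i → aug r i ⊸ aug r′ i → Set (a ⊔ ℓ)
      Step i φ = Σ (r i ⊸ r′ i) λ φ′ → ∀ v → fn φ (fn (X.d i) v) ≋ fn (Y.d i) (fn φ′ v)

      -- The square in degree i is kept with the maps, since it is what makes the next composite a
      -- cycle in `Y`.
      build : ∀ i → Σ (aug r i ⊸ aug r′ i) (Step i)
      build zero = φ₀ , factor (φ₀ ∘ₗ X.d 0) (Y.d 0) im₀
      build (suc i) with build i
      ... | φ , φ′ , comm = φ′ , factor (φ′ ∘ₗ X.d (suc i)) (Y.d (suc i)) λ v →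
        Y.exact i _ (≋-trans (≋-sym (comm _)) (≋-trans (cong φ (X.complex i v)) (0-homo φ)))

    chain : ∀ i → aug r i ⊸ aug r′ i
    chain i = proj₁ (build i)

    chain-comm : ∀ i v → fn (chain i) (fn (X.d i) v) ≋ fn (Y.d i) (fn (chain (suc i)) v)
    chain-comm i = proj₂ (proj₂ (build i))

  -- The homotopy from `γ` to the identity is built degree by degree: `defect` is the part of the
  -- identity not yet accounted for by `γ` and s ∘ d. It consists of cycles, and lifting it along
  -- the next differential gives the next `s`. The start `s 0` can be zero because `γ 0` is the
  -- identity.
  module Homotopy {r} (X : Acyclic r) (γ : ∀ i → aug r i ⊸ aug r i)
    (γ₀ : ∀ v → fn (γ 0) v ≋ v)
    (comm : ∀ i v → fn (γ i) (fn (Acyclic.d X i) v) ≋ fn (Acyclic.d X i) (fn (γ (suc i)) v)) where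
    open Acyclic X

    private
      defect : ∀ i → aug r i ⊸ r i → r i ⊸ r i
      defect i s = idₗ +ₗ (-ₗ (γ (suc i) +ₗ s ∘ₗ d i))

      d-defect : ∀ i s v → fn (d i) (fn (defect i s) v) ≋
        fn (d i) v ⊞ ⊟ (fn (γ i) (fn (d i) v) ⊞ fn (d i) (fn s (fn (d i) v)))
      d-defect i s v j = begin
        fn (d i) (fn (defect i s) v) j  ≈⟨ +-homo (d i) _ _ j ⟩
        fn (d i) v j +ᴿ fn (d i) (⊟ (fn (γ (suc i)) v ⊞ fn s (fn (d i) v))) j
          ≈⟨ +-congˡ (⊟-homo (d i) _ j) ⟩
        fn (d i) v j +ᴿ - fn (d i) (fn (γ (suc i)) v ⊞ fn s (fn (d i) v)) j
          ≈⟨ +-congˡ (-‿cong (+-homo (d i) _ _ j)) ⟩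
        fn (d i) v j +ᴿ - (fn (d i) (fn (γ (suc i)) v) j +ᴿ fn (d i) (fn s (fn (d i) v)) j)
          ≈⟨ +-congˡ (-‿cong (+-congʳ (comm i v j))) ⟨
        fn (d i) v j +ᴿ - (fn (γ i) (fn (d i) v) j +ᴿ fn (d i) (fn s (fn (d i) v)) j) ∎

      Killed : ∀ i → aug r i ⊸ r i → Set (a ⊔ ℓ)
      Killed i s = ∀ v → fn (d i) (fn (defect i s) v) ≋ 0ᵛ

      Factors : ∀ i → aug r i ⊸ r i → r i ⊸ r (suc i) → Set (a ⊔ ℓ)
      Factors i s s′ = ∀ v → fn (defect i s) v ≋ fn (d (suc i)) (fn s′ v)

      next : ∀ i s → Killed i s → Σ (r i ⊸ r (suc i)) (Factors i s)
      next i s killed = factor (defect i s) (d (suc i)) (λ v → exact i _ (killed v))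

      -- `fac` turns d s′ d v into the defect one degree lower, taken at d v. Its term with `s`
      -- contains d ∘ d and vanishes, and the remaining terms cancel.
      killed-next : ∀ i s s′ → Factors i s s′ → Killed (suc i) s′
      killed-next i s s′ fac v j = begin
        fn (d (suc i)) (fn (defect (suc i) s′) v) j  ≈⟨ d-defect (suc i) s′ v j ⟩
        dv j +ᴿ - (fn (γ (suc i)) dv j +ᴿ fn (d (suc i)) (fn s′ dv) j)
          ≈⟨ +-congˡ (-‿cong (+-congˡ (fac dv j))) ⟨
        dv j +ᴿ - (g +ᴿ (dv j +ᴿ - (g +ᴿ fn s (fn (d i) dv) j)))
          ≈⟨ +-congˡ (-‿cong (+-congˡ (+-congˡ (-‿cong (+-congˡ
               (≋-trans (cong s (complex i v)) (0-homo s) j)))))) ⟩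
        dv j +ᴿ - (g +ᴿ (dv j +ᴿ - (g +ᴿ 0#)))
          ≈⟨ +-congˡ (-‿cong (+-congˡ (+-congˡ (-‿cong (+-identityʳ g))))) ⟩
        dv j +ᴿ - (g +ᴿ (dv j +ᴿ - g))
          ≈⟨ +-congˡ (-‿cong (trans (+-congˡ (+-comm _ _)) (trans (sym (+-assoc _ _ _))
               (trans (+-congʳ (-‿inverseʳ g)) (+-identityˡ _))))) ⟩
        dv j +ᴿ - dv j  ≈⟨ -‿inverseʳ _ ⟩
        0#  ∎
        where
        dv = fn (d (suc i)) v
        g  = fn (γ (suc i)) dv j

      build : ∀ i → Σ (aug r i ⊸ r i) (Killed i)
      build zero = 0ₗ , λ v j → begin
        fn (d 0) (fn (defect 0 0ₗ) v) j  ≈⟨ d-defect 0 0ₗ v j ⟩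
        fn (d 0) v j +ᴿ - (fn (γ 0) (fn (d 0) v) j +ᴿ fn (d 0) 0ᵛ j)
          ≈⟨ +-congˡ (-‿cong (+-cong (γ₀ _ j) (0-homo (d 0) j))) ⟩
        fn (d 0) v j +ᴿ - (fn (d 0) v j +ᴿ 0#)
          ≈⟨ +-congˡ (-‿cong (+-identityʳ _)) ⟩
        fn (d 0) v j +ᴿ - fn (d 0) v j  ≈⟨ -‿inverseʳ _ ⟩
        0# ∎
      build (suc i) with build i
      ... | s , killed with next i s killed
      ... | s′ , fac = s′ , killed-next i s s′ fac

    s : ∀ i → aug r i ⊸ r i
    s i = proj₁ (build i)

    homotopy : ∀ i v → v ≋ (fn (γ (suc i)) v ⊞ fn (s i) (fn (d i) v)) ⊞ fn (d (suc i)) (fn (s (suc i)) v)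
    homotopy i v j = begin
      v j                        ≈⟨ +-identityʳ _ ⟨
      v j +ᴿ 0#                  ≈⟨ +-congˡ (-‿inverseˡ x) ⟨
      v j +ᴿ (- x +ᴿ x)          ≈⟨ +-assoc _ _ _ ⟨
      (v j +ᴿ - x) +ᴿ x          ≈⟨ +-comm _ _ ⟩
      x +ᴿ (v j +ᴿ - x)          ≈⟨ +-congˡ (proj₂ (next i (s i) (proj₂ (build i))) v j) ⟩
      x +ᴿ fn (d (suc i)) (fn (s (suc i)) v) j ∎
      where x = fn (γ (suc i)) v j +ᴿ fn (s i) (fn (d i) v) j

  -- The R ^ 1 that ends H becomes a summand in degree 0, whence the ranks `r i + aug r′ i`. The
  -- hypothesis `injective` says that `φ 0` induces an injection from R modulo the image of H to R
  -- modulo the image of G, which is exactness of the cone in degree 0.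
  module Cone {r r′} (G : Acyclic r) (H : Acyclic r′)
    (φ : ∀ i → aug r′ i ⊸ aug r i)
    (comm : ∀ i v → fn (φ i) (fn (Acyclic.d H i) v) ≋ fn (Acyclic.d G i) (fn (φ (suc i)) v))
    (injective : ∀ v w → fn (Acyclic.d G 0) v ⊞ fn (φ 0) w ≋ 0ᵛ → ∃[ u ] w ≋ fn (Acyclic.d H 0) u)
    where

    private
      module G = Acyclic G
      module H = Acyclic H

    ranks : ℕ → ℕ
    ranks i = r i + aug r′ i

    top : ∀ i → ranks i ⊸ aug r i
    top i = G.d i ∘ₗ fstₗ +ₗ φ i ∘ₗ sndₗ {r i}

    bottom : ∀ i → ranks (suc i) ⊸ aug r′ i
    bottom i = H.d i ∘ₗ (-ₗ sndₗ {r (suc i)})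

    D : ∀ i → ranks i ⊸ aug ranks i
    D zero    = top zero
    D (suc i) = pairₗ (top (suc i)) (bottom i)

    private
      fst-pair : ∀ i v → fn fstₗ (fn (D (suc i)) v) ≋ fn (top (suc i)) v
      fst-pair i v = fst-∥ (fn (top (suc i)) v) (fn (bottom i) v)

      snd-pair : ∀ i v → fn (sndₗ {r i}) (fn (D (suc i)) v) ≋ fn (bottom i) v
      snd-pair i v = snd-∥ (fn (top (suc i)) v) (fn (bottom i) v)

      top-complex : ∀ i v → fn (top i) (fn (D (suc i)) v) ≋ 0ᵛ
      top-complex i v j = begin
        fn (top i) (fn (D (suc i)) v) j
          ≈⟨ +-cong (cong (G.d i) (fst-pair i v) j) (cong (φ i) (snd-pair i v) j) ⟩
        fn (G.d i) (fn (G.d (suc i)) g ⊞ fn (φ (suc i)) h) j +ᴿ fn (φ i) (fn (H.d i) (⊟ h)) j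
          ≈⟨ +-cong (+-homo (G.d i) _ _ j) (comm i (⊟ h) j) ⟩
        (fn (G.d i) (fn (G.d (suc i)) g) j +ᴿ fn (G.d i) (fn (φ (suc i)) h) j)
          +ᴿ fn (G.d i) (fn (φ (suc i)) (⊟ h)) j
          ≈⟨ +-cong (trans (+-congʳ (G.complex i g j)) (+-identityˡ _))
               (≋-trans (cong (G.d i) (⊟-homo (φ (suc i)) h)) (⊟-homo (G.d i) _) j) ⟩
        fn (G.d i) (fn (φ (suc i)) h) j +ᴿ - fn (G.d i) (fn (φ (suc i)) h) j
          ≈⟨ -‿inverseʳ _ ⟩
        0# ∎
        where
        g = fn fstₗ v
        h = fn (sndₗ {r (suc i)}) v

      -- If the H-part is d w, adding φ w turns the G-part into a cycle, hence into some d u. The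
      -- differential of the cone has a sign on the H-summand, so the preimage is (u, -w).
      exact-from : ∀ i v → fn (top i) v ≋ 0ᵛ → (∃[ w ] fn (sndₗ {r i}) v ≋ fn (H.d i) w) →
                   ∃[ w ] v ≋ fn (D (suc i)) w
      exact-from i v top≋0 (w , h≋) = (u ∥ ⊟ w) , ∥-ext {r i} {aug r′ i}
          (≋-trans left (≋-sym (fst-pair i (u ∥ ⊟ w))))
          (≋-trans right (≋-sym (snd-pair i (u ∥ ⊟ w))))
        where
        g = fn fstₗ v
        cycle : fn (G.d i) (g ⊞ fn (φ (suc i)) w) ≋ 0ᵛ
        cycle j = begin
          fn (G.d i) (g ⊞ fn (φ (suc i)) w) j   ≈⟨ +-homo (G.d i) _ _ j ⟩
          fn (G.d i) g j +ᴿ fn (G.d i) (fn (φ (suc i)) w) j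
            ≈⟨ +-congˡ (≋-trans (cong (φ i) h≋) (comm i w) j) ⟨
          fn (top i) v j  ≈⟨ top≋0 j ⟩
          0#  ∎
        u = proj₁ (G.exact i _ cycle)
        left : g ≋ fn (top (suc i)) (u ∥ ⊟ w)
        left j = begin
          g j                                 ≈⟨ +-identityʳ _ ⟨
          g j +ᴿ 0#                           ≈⟨ +-congˡ (-‿inverseʳ x) ⟨
          g j +ᴿ (x +ᴿ - x)                   ≈⟨ +-assoc _ _ _ ⟨
          (g j +ᴿ x) +ᴿ - x                   ≈⟨ +-congʳ (proj₂ (G.exact i _ cycle) j) ⟩
          fn (G.d (suc i)) u j +ᴿ - x         ≈⟨ +-congˡ (⊟-homo (φ (suc i)) w j) ⟨
          fn (G.d (suc i)) u j +ᴿ fn (φ (suc i)) (⊟ w) j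
            ≈⟨ +-cong (cong (G.d (suc i)) (fst-∥ u (⊟ w)) j)
                 (cong (φ (suc i)) (snd-∥ {r (suc i)} u (⊟ w)) j) ⟨
          fn (top (suc i)) (u ∥ ⊟ w) j ∎
          where x = fn (φ (suc i)) w j
        right : fn (sndₗ {r i}) v ≋ fn (bottom i) (u ∥ ⊟ w)
        right = ≋-trans h≋ (cong (H.d i) λ j →
          trans (sym (-‿involutive (w j))) (-‿cong (sym (snd-∥ {r (suc i)} u (⊟ w) j))))

    cone : Acyclic ranks
    cone .Acyclic.d = D
    cone .Acyclic.complex zero v = top-complex 0 v
    cone .Acyclic.complex (suc i) v = ∥-ext {r i} {aug r′ i}
      (≋-trans (fst-pair i w) (top-complex (suc i) v))
      (≋-trans (snd-pair i w) (≋-trans (cong (H.d i) step)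
        (≋-trans (⊟-homo (H.d i) _) (λ j → trans (-‿cong (H.complex i _ j)) -0#≈0#))))
      where
      w = fn (D (suc (suc i))) v
      step : fn (-ₗ sndₗ {r (suc i)}) w ≋ ⊟ fn (H.d (suc i)) (fn (-ₗ sndₗ {r (suc (suc i))}) v)
      step j = -‿cong (snd-pair (suc i) v j)
    cone .Acyclic.exact zero v Dv≋0 = exact-from 0 v Dv≋0 (injective _ _ Dv≋0)
    cone .Acyclic.exact (suc i) v Dv≋0 = exact-from (suc i) v
      (≋-trans (≋-sym (fst-pair i v)) (λ j → Dv≋0 (j ↑ˡ _)))
      (⊟ proj₁ e , λ j → trans (sym (-‿involutive _))
        (trans (-‿cong (proj₂ e j)) (sym (⊟-homo (H.d (suc i)) _ j))))
      where
      e = H.exact i (⊟ fn (sndₗ {r (suc i)}) v)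
            (≋-trans (≋-sym (snd-pair i v)) (λ j → Dv≋0 (r i ↑ʳ j)))

  module Comparison {r r′} (X : Acyclic r) (Y : Acyclic r′)
    (X⇒Y : ∀ f → Acyclic.Image X f → Acyclic.Image Y f)
    (Y⇒X : ∀ f → Acyclic.Image Y f → Acyclic.Image X f) where

    private
      module X = Acyclic X
      module Y = Acyclic Y

      im-XY : ∀ v → ∃[ w ] fn (X.d 0) v ≋ fn (Y.d 0) w
      im-XY v with X⇒Y _ (v , λ { zero → refl })
      ... | w , eq = w , λ { zero → eq zero }

      im-YX : ∀ v → ∃[ w ] fn (Y.d 0) v ≋ fn (X.d 0) w
      im-YX v with Y⇒X _ (v , λ { zero → refl })
      ... | w , eq = w , λ { zero → eq zero }

      module α = ChainMap X Y idₗ im-XY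
      module β = ChainMap Y X idₗ im-YX
      module H = Homotopy X (λ i → β.chain i ∘ₗ α.chain i) (λ v i → refl)
        (λ i v → ≋-trans (cong (β.chain i) (α.chain-comm i v)) (β.chain-comm i _))

    open H public using (s)

    -- Where `Y` has rank 0 the round trip X → Y → X is zero, so the homotopy between it and the
    -- identity contracts `X` there.
    contraction : ∀ i → r′ i ≡ 0 → ∀ v → v ≋ fn (s i) (fn (X.d i) v) ⊞ fn (X.d (suc i)) (fn (s (suc i)) v)
    contraction i r′≡0 v j = begin
      v j                                    ≈⟨ H.homotopy i v j ⟩
      (fn (β.chain (suc i)) αv j +ᴿ sd) +ᴿ ds
        ≈⟨ +-congʳ (+-congʳ (≋-trans (cong (β.chain (suc i)) (trivial r′≡0 αv)) (0-homo (β.chain (suc i))) j)) ⟩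
      (0# +ᴿ sd) +ᴿ ds                       ≈⟨ +-congʳ (+-identityˡ _) ⟩
      sd +ᴿ ds                               ∎
      where
      αv = fn (α.chain (suc i)) v
      sd = fn (s i) (fn (X.d i) v) j
      ds = fn (X.d (suc i)) (fn (s (suc i)) v) j
      trivial : ∀ {m} → m ≡ 0 → (u : Vector Carrier m) → u ≋ 0ᵛ
      trivial ≡.refl u ()

-- Linear resolutions over graded rings

-- Given by the projections onto the homogeneous components; x has degree k when `π k x ≈ x`.
-- Together with `π-1`, the law `π-*` at y = 1 makes each projection idempotent.
record Grading {a ℓ} (R : CommutativeRing a ℓ) : Set (a ⊔ ℓ) where
  open CommutativeRing R renaming (_+_ to _+ᴿ_)
  field
    π      : ℕ → Carrier → Carrier
    π-cong : ∀ k {x y} → x ≈ y → π k x ≈ π k y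
    π-+    : ∀ k x y → π k (x +ᴿ y) ≈ π k x +ᴿ π k y
    π-*    : ∀ j k x y → π (j + k) (π j x * y) ≈ π j x * π k y
    π-1    : π 0 1# ≈ 1#

module GradedMaps {a ℓ} (R : CommutativeRing a ℓ) (gradingR : Grading R) where
  open CommutativeRing R hiding (zero) renaming (_+_ to _+ᴿ_)
  open RingProperties ring using (x+x≈x⇒x≈0; +-inverseˡ-unique)
  open LinearAlgebra rawRing
  open LinearMaps R
  open _⊸_
  open Grading gradingR
  open SetoidReasoning setoid

  π-0 : ∀ k → π k 0# ≈ 0#
  π-0 k = x+x≈x⇒x≈0 _ (trans (sym (π-+ k 0# 0#)) (π-cong k (+-identityˡ 0#)))

  π-neg : ∀ k x → π k (- x) ≈ - π k x
  π-neg k x = +-inverseˡ-unique _ _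
    (trans (sym (π-+ k (- x) x)) (trans (π-cong k (-‿inverseˡ x)) (π-0 k)))

  π-sum : ∀ {m} k (v : Vector Carrier m) → π k (sum v) ≈ sum (λ i → π k (v i))
  π-sum {zero}  k v = π-0 k
  π-sum {suc m} k v = trans (π-+ k _ _) (+-congˡ (π-sum k (λ i → v (suc i))))

  πᵛ : ∀ {m} → ℕ → Vector Carrier m → Vector Carrier m
  πᵛ k v i = π k (v i)

  π-basis : ∀ {m} (s : Fin m) → πᵛ 0 (basis s) ≋ basis s
  π-basis zero    zero    = π-1
  π-basis zero    (suc i) = π-0 0
  π-basis (suc s) zero    = π-0 0
  π-basis (suc s) (suc i) = π-basis s i

  -- The free modules are not shifted: basis vectors have degree 0 and the map raises degrees by e.
  -- Thus all entries of its matrix are homogeneous of degree e.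
  Graded : ∀ {m r} → ℕ → m ⊸ r → Set (a ⊔ ℓ)
  Graded e f = ∀ k v → fn f (πᵛ k v) ≋ πᵛ (e + k) (fn f v)

  graded-basis : ∀ {m r e} (f : m ⊸ r) → Graded e f → ∀ s → πᵛ e (fn f (basis s)) ≋ fn f (basis s)
  graded-basis {e = e} f f-graded s i = begin
    π e (fn f (basis s) i)        ≈⟨ reflexive (≡.cong (λ k → π k (fn f (basis s) i)) (ℕ.+-identityʳ e)) ⟨
    π (e + 0) (fn f (basis s) i)  ≈⟨ f-graded 0 (basis s) i ⟨
    fn f (πᵛ 0 (basis s)) i       ≈⟨ cong f (π-basis s) i ⟩
    fn f (basis s) i              ∎

  graded-∘-reindex : ∀ {k m r e} (f : m ⊸ r) (ρ : Fin m → Fin k) → Graded e f → Graded e (f ∘ₗ reindex ρ)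
  graded-∘-reindex f ρ f-graded k v = f-graded k (fn (reindex ρ) v)

  graded-+ : ∀ {m r e} (f g : m ⊸ r) → Graded e f → Graded e g → Graded e (f +ₗ g)
  graded-+ f g f-graded g-graded k v i =
    trans (+-cong (f-graded k v i) (g-graded k v i)) (sym (π-+ _ _ _))

  graded-∘-neg : ∀ {k m r e} (f : m ⊸ r) (ρ : Fin m → Fin k) → Graded e f → Graded e (f ∘ₗ (-ₗ reindex ρ))
  graded-∘-neg f ρ f-graded k v =
    ≋-trans (cong f (λ i → sym (π-neg k _))) (f-graded k (⊟ fn (reindex ρ) v))

  graded-pair : ∀ {k m r e} (f : k ⊸ m) (g : k ⊸ r) → Graded e f → Graded e g → Graded e (pairₗ f g)
  graded-pair {m = m} f g f-graded g-graded k v i with splitAt m i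
  ... | inj₁ j = f-graded k v j
  ... | inj₂ j = g-graded k v j

  component : ∀ {m r} → ℕ → m ⊸ r → m ⊸ r
  component e f = lin (λ s → πᵛ e (fn f (basis s)))

  component-graded : ∀ {m r} e (f : m ⊸ r) → Graded e (component e f)
  component-graded {m} e f k v i = sym (begin
    π (e + k) (sum {m} (λ s → v s * π e (fn f (basis s) i)))
      ≈⟨ π-sum {m} (e + k) _ ⟩
    sum {m} (λ s → π (e + k) (v s * π e (fn f (basis s) i)))
      ≈⟨ sum-cong {m} (λ s → trans (π-cong (e + k) (*-comm _ _))
           (trans (π-* e k _ (v s)) (*-comm _ _))) ⟩
    sum {m} (λ s → π k (v s) * π e (fn f (basis s) i)) ∎)

  -- This lets a commuting square survive the passage to `component`: on homogeneous input, taking a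
  -- part of the map amounts to taking a part of the output.
  component-homogeneous : ∀ {m r} e (f : m ⊸ r) k v → πᵛ k v ≋ v →
                          fn (component e f) v ≋ πᵛ (k + e) (fn f v)
  component-homogeneous {m} e f k v v-hom i = begin
    sum {m} (λ s → v s * π e (F s))
      ≈⟨ sum-cong {m} (λ s → *-congʳ (v-hom s)) ⟨
    sum {m} (λ s → π k (v s) * π e (F s))
      ≈⟨ sum-cong {m} (λ s → trans (π-cong (k + e) (*-congʳ (sym (v-hom s)))) (π-* k e (v s) (F s))) ⟨
    sum {m} (λ s → π (k + e) (v s * F s))   ≈⟨ π-sum {m} (k + e) (λ s → v s * F s) ⟨
    π (k + e) (sum {m} (λ s → v s * F s))   ≈⟨ π-cong (k + e) (expand f v i) ⟨
    π (k + e) (fn f v i)                ∎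
    where F = λ s → fn f (basis s) i

  -- In a linear resolution of R/I with I generated in degree e, the augmentation
  -- R ← F₀ has degree e and all other maps have degree 1.
  deg : ℕ → ℕ → ℕ
  deg e zero    = e
  deg e (suc i) = 1

  deg-1 : ∀ i → deg 1 i ≡ 1
  deg-1 zero    = ≡.refl
  deg-1 (suc i) = ≡.refl

  record LinearResolution {p} (e : ℕ) (r : ℕ → ℕ) (I : Carrier → Set p) : Set (a ⊔ ℓ ⊔ p) where
    field
      acyclic : Acyclic r
    open Acyclic acyclic public
    field
      graded  : ∀ i → Graded (deg e i) (d i)
      image   : ∀ f → I f → Image f
      image⁻¹ : ∀ f → Image f → I f

  zero-resolution : ∀ e → LinearResolution e (λ _ → 0) (λ f → f ≈ 0#)
  zero-resolution e = record
    { acyclic = record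
      { d       = λ i → 0ₗ
      ; complex = λ i v j → refl
      ; exact   = λ i v _ → v , λ ()
      }
    ; graded  = λ i k v j → sym (π-0 _)
    ; image   = λ f f≈0 → 0ᵛ , λ _ → f≈0
    ; image⁻¹ = λ f (_ , f≈0) → f≈0 zero
    }

  module _ {p q} {e r r′} {I : Carrier → Set p} {J : Carrier → Set q}
    (G : LinearResolution e r I) (H : LinearResolution 1 r′ J)
    (m : Carrier) (m-homogeneous : π e m ≈ m)
    (J⇒colon : ∀ f → J f → I (m * f)) (colon⇒J : ∀ f → I (m * f) → J f) where

    private
      module G = LinearResolution G
      module H = LinearResolution H

      lifts : ∀ v → ∃[ w ] fn (mul m) (fn (H.d 0) v) ≋ fn (G.d 0) w
      lifts v with G.image _ (J⇒colon _ (H.image⁻¹ (fn (H.d 0) v zero) (v , λ { zero → refl })))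
      ... | w , eq = w , λ { zero → eq zero }

      module C = ChainMap H.acyclic G.acyclic (mul m) lifts

      -- The chain map supplied by exactness may mix degrees. Keeping its part of degree e on R ^ 1
      -- and its linear part elsewhere makes the matrices of the cone linear.
      φ : ∀ i → aug r′ i ⊸ aug r i
      φ i = component (deg e i) (C.chain i)

      φ₀ : ∀ v → fn (φ 0) v ≋ m ∙ v
      φ₀ = ext (φ 0) (mul m) λ { zero zero → begin
        fn (φ 0) (basis zero) zero  ≈⟨ lin-basis {1} {1} (λ s → πᵛ e (fn (mul m) (basis s))) zero zero ⟩
        π e (m * 1#)                ≈⟨ π-cong e (*-identityʳ m) ⟩
        π e m                       ≈⟨ m-homogeneous ⟩
        m                           ≈⟨ *-identityʳ m ⟨
        m * 1#                      ∎ }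

      -- The differentials of G and H are homogeneous, so at a basis vector both sides are the part
      -- of degree `1 + deg e i` of the square of the original chain map.
      comm : ∀ i v → fn (φ i) (fn (H.d i) v) ≋ fn (G.d i) (fn (φ (suc i)) v)
      comm i = ext (φ i ∘ₗ H.d i) (G.d i ∘ₗ φ (suc i)) λ s j → begin
        fn (φ i) (fn (H.d i) (basis s)) j
          ≈⟨ component-homogeneous (deg e i) (C.chain i) 1 _ (linear s) j ⟩
        π (1 + deg e i) (fn (C.chain i) (fn (H.d i) (basis s)) j)
          ≈⟨ π-cong _ (C.chain-comm i (basis s) j) ⟩
        π (1 + deg e i) (fn (G.d i) (fn (C.chain (suc i)) (basis s)) j)
          ≈⟨ reflexive (≡.cong (λ k → π k (fn (G.d i) (fn (C.chain (suc i)) (basis s)) j)) (ℕ.+-comm 1 (deg e i))) ⟩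
        π (deg e i + 1) (fn (G.d i) (fn (C.chain (suc i)) (basis s)) j)
          ≈⟨ G.graded i 1 _ j ⟨
        fn (G.d i) (πᵛ 1 (fn (C.chain (suc i)) (basis s))) j
          ≈⟨ cong (G.d i) (lin-basis _ s) j ⟨
        fn (G.d i) (fn (φ (suc i)) (basis s)) j ∎
        where
        linear : ∀ s → πᵛ 1 (fn (H.d i) (basis s)) ≋ fn (H.d i) (basis s)
        linear = graded-basis (H.d i) (≡.subst (λ k → Graded k (H.d i)) (deg-1 i) (H.graded i))

      -- The hypothesis puts m w in I, so w lies in the colon ideal I : m, which is J.
      injective : ∀ v w → fn (G.d 0) v ⊞ fn (φ 0) w ≋ 0ᵛ → ∃[ u ] w ≋ fn (H.d 0) u
      injective v w sum≋0 with H.image (w zero) (colon⇒J (w zero) (G.image⁻¹ _ (⊟ v , λ { zero → step })))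
        where
        step : m * w zero ≈ fn (G.d 0) (⊟ v) zero
        step = begin
          m * w zero                ≈⟨ φ₀ w zero ⟨
          fn (φ 0) w zero           ≈⟨ +-inverseˡ-unique _ _ (trans (+-comm _ _) (sum≋0 zero)) ⟩
          - fn (G.d 0) v zero       ≈⟨ ⊟-homo (G.d 0) v zero ⟨
          fn (G.d 0) (⊟ v) zero     ∎
      ... | u , eq = u , λ { zero → eq zero }

      module K = Cone G.acyclic H.acyclic φ comm injective

    cone-resolution : LinearResolution e (λ i → r i + aug r′ i) (λ f → ∃[ g ] ∃[ h ] I g × f ≈ g +ᴿ m * h)
    cone-resolution = record
      { acyclic = K.cone
      ; graded  = graded
      ; image   = λ { f (g , h , Ig , f≈) → image f g h (G.image g Ig) f≈ }
      ; image⁻¹ = λ { f (v , f≈) →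
          fn (G.d 0) (fn fstₗ v) zero , fn (sndₗ {r 0}) v zero
          , G.image⁻¹ _ (fn fstₗ v , λ { zero → refl })
          , trans (f≈ zero) (+-congˡ (φ₀ (fn (sndₗ {r 0}) v) zero)) }
      }
      where
      top-graded : ∀ i → Graded (deg e i) (K.top i)
      top-graded i = graded-+ (G.d i ∘ₗ fstₗ) (φ i ∘ₗ sndₗ {r i})
        (graded-∘-reindex (G.d i) _ (G.graded i))
        (graded-∘-reindex (φ i) _ (component-graded (deg e i) (C.chain i)))
      graded : ∀ i → Graded (deg e i) (K.D i)
      graded zero = top-graded zero
      graded (suc i) = graded-pair (K.top (suc i)) (K.bottom i) (top-graded (suc i))
        (graded-∘-neg (H.d i) _ (≡.subst (λ k → Graded k (H.d i)) (deg-1 i) (H.graded i)))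
      image : ∀ f g h → G.Image g → f ≈ g +ᴿ m * h → Acyclic.Image K.cone f
      image f g h (v , g≈) f≈ = (v ∥ λ _ → h) , λ { zero → begin
        f               ≈⟨ f≈ ⟩
        g +ᴿ m * h      ≈⟨ +-cong (g≈ zero) (sym (φ₀ (λ _ → h) zero)) ⟩
        fn (G.d 0) v zero +ᴿ fn (φ 0) (λ _ → h) zero
          ≈⟨ +-cong (cong (G.d 0) (fst-∥ v _) zero) (cong (φ 0) (snd-∥ {r 0} v _) zero) ⟨
        fn (K.top 0) (v ∥ λ _ → h) zero ∎ }

-- The polynomial ring

module PolynomialRing {c ℓ₁ ℓ₂} (𝕂 : HeytingField c ℓ₁ ℓ₂) (n : ℕ) where
  open OverField 𝕂 public
  open Polynomials n public

  K : CommutativeRing c ℓ₁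
  K = HeytingCommutativeRing.commutativeRing (HeytingField.heytingCommutativeRing 𝕂)

  module K = CommutativeRing K
  module K-Properties = RingProperties K.ring

  -- In the zero ring 1 - 0 is invertible, so 1 would be apart from 0.
  1≉0 : ¬ (K.1# K.≈ K.0#)
  1≉0 1≈0 = HeytingField.#-irrefl 𝕂 1≈0 (HeytingField.invertible⇒# 𝕂
      (K.1# , K.trans (K.*-identityˡ _) 1-0≈1 , K.trans (K.*-identityʳ _) 1-0≈1))
    where
    1-0≈1 : K.1# K.- K.0# K.≈ K.1#
    1-0≈1 = K.trans (K.+-congˡ K-Properties.-0#≈0#) (K.+-identityʳ _)

  _≟ᵐ_ : (k m : Monomial) → Dec (k ≡ m)
  _≟ᵐ_ = Vec.≡-dec ℕ._≟_

  _∣ᵐ?_ : (k m : Monomial) → Dec (k ∣ᵐ m)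
  _∣ᵐ?_ = Pointwise.decidable ℕ._≤?_

  _÷_ : Monomial → Monomial → Monomial
  _÷_ = Vec.zipWith _∸_

  *ᵐ-comm : ∀ k l → k *ᵐ l ≡ l *ᵐ k
  *ᵐ-comm = Vec.zipWith-comm ℕ.+-comm

  *ᵐ-assoc : ∀ k l m → (k *ᵐ l) *ᵐ m ≡ k *ᵐ (l *ᵐ m)
  *ᵐ-assoc = Vec.zipWith-assoc ℕ.+-assoc

  *ᵐ-identityˡ : ∀ m → 1ᵐ *ᵐ m ≡ m
  *ᵐ-identityˡ = Vec.zipWith-identityˡ ℕ.+-identityˡ

  private
    ∣-*′ : ∀ {n} (k l : Vec ℕ n) → Pointwise _≤_ k (Vec.zipWith _+_ k l)
    ∣-*′ []      []      = []
    ∣-*′ (x ∷ k) (y ∷ l) = ℕ.m≤m+n x y ∷ ∣-*′ k l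

    *-÷′ : ∀ {n} {k m : Vec ℕ n} → Pointwise _≤_ k m → Vec.zipWith _+_ k (Vec.zipWith _∸_ m k) ≡ m
    *-÷′ []       = ≡.refl
    *-÷′ (p ∷ ps) = ≡.cong₂ _∷_ (ℕ.m+[n∸m]≡n p) (*-÷′ ps)

    ÷-*′ : ∀ {n} (k l : Vec ℕ n) → Vec.zipWith _∸_ (Vec.zipWith _+_ k l) k ≡ l
    ÷-*′ []      []      = ≡.refl
    ÷-*′ (x ∷ k) (y ∷ l) = ≡.cong₂ _∷_ (ℕ.m+n∸m≡n x y) (÷-*′ k l)

    1-factorˡ′ : ∀ {n} (k l : Vec ℕ n) → Vec.zipWith _+_ k l ≡ Vec.replicate n 0 → k ≡ Vec.replicate n 0
    1-factorˡ′ []      []      _  = ≡.refl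
    1-factorˡ′ (x ∷ k) (y ∷ l) eq = ≡.cong₂ _∷_
      (ℕ.m+n≡0⇒m≡0 x (Vec.∷-injectiveˡ eq)) (1-factorˡ′ k l (Vec.∷-injectiveʳ eq))

  ∣-* : ∀ k l → k ∣ᵐ (k *ᵐ l)
  ∣-* = ∣-*′

  *-÷ : ∀ {k m} → k ∣ᵐ m → k *ᵐ (m ÷ k) ≡ m
  *-÷ = *-÷′

  ÷-* : ∀ k l → (k *ᵐ l) ÷ k ≡ l
  ÷-* = ÷-*′

  1-factorˡ : ∀ k l → k *ᵐ l ≡ 1ᵐ → k ≡ 1ᵐ
  1-factorˡ = 1-factorˡ′

  ∣ᵐ-trans : ∀ {k l m} → k ∣ᵐ l → l ∣ᵐ m → k ∣ᵐ m
  ∣ᵐ-trans = Pointwise.trans ℕ.≤-trans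

  ∣ᵐ-refl : ∀ {m} → m ∣ᵐ m
  ∣ᵐ-refl = Pointwise.refl ℕ.≤-refl

  -- The ring structure on formal sums, by linear functionals

  eval : Poly → (Monomial → K.Carrier) → K.Carrier
  eval []            φ = K.0#
  eval ((a , k) ∷ p) φ = a K.* φ k K.+ eval p φ

  δ : Monomial → Monomial → K.Carrier
  δ m k = if does (k ≟ᵐ m) then K.1# else K.0#

  module R₀ = RawRing polynomialRing

  open SetoidReasoning K.setoid

  δ-yes : ∀ {m k} → k ≡ m → δ m k ≡ K.1#
  δ-yes {m} {k} k≡m rewrite dec-true (k ≟ᵐ m) k≡m = ≡.refl

  δ-no : ∀ {m k} → k ≢ m → δ m k ≡ K.0#
  δ-no {m} {k} k≢m rewrite dec-false (k ≟ᵐ m) k≢m = ≡.refl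

  coeff-eval : ∀ p m → coeff p m K.≈ eval p (δ m)
  coeff-eval []            m = K.refl
  coeff-eval ((a , k) ∷ p) m with k ≟ᵐ m
  ... | yes _ = K.+-cong (K.sym (K.*-identityʳ a)) (coeff-eval p m)
  ... | no  _ = begin
    coeff p m                        ≈⟨ coeff-eval p m ⟩
    eval p (δ m)                     ≈⟨ K.+-identityˡ _ ⟨
    K.0# K.+ eval p (δ m)            ≈⟨ K.+-congʳ (K.zeroʳ a) ⟨
    a K.* K.0# K.+ eval p (δ m)      ∎

  eval-cong : ∀ p {φ ψ} → (∀ m → φ m K.≈ ψ m) → eval p φ K.≈ eval p ψ
  eval-cong []            φ≈ψ = K.refl
  eval-cong ((a , k) ∷ p) φ≈ψ = K.+-cong (K.*-congˡ (φ≈ψ k)) (eval-cong p φ≈ψ)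

  eval-++ : ∀ p q φ → eval (p ++ q) φ K.≈ eval p φ K.+ eval q φ
  eval-++ []            q φ = K.sym (K.+-identityˡ _)
  eval-++ ((a , k) ∷ p) q φ = K.trans (K.+-congˡ (eval-++ p q φ)) (K.sym (K.+-assoc _ _ _))

  eval-zero : ∀ p → eval p (λ _ → K.0#) K.≈ K.0#
  eval-zero []            = K.refl
  eval-zero ((a , k) ∷ p) = K.trans (K.+-cong (K.zeroʳ a) (eval-zero p)) (K.+-identityˡ _)

  eval-+ : ∀ p φ ψ → eval p (λ m → φ m K.+ ψ m) K.≈ eval p φ K.+ eval p ψ
  eval-+ []            φ ψ = K.sym (K.+-identityˡ _)
  eval-+ ((a , k) ∷ p) φ ψ = K.trans
    (K.+-cong (K.distribˡ a (φ k) (ψ k)) (eval-+ p φ ψ))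
    (LinearMaps.interchange K _ _ _ _)

  eval-* : ∀ p b φ → eval p (λ m → b K.* φ m) K.≈ b K.* eval p φ
  eval-* []            b φ = K.sym (K.zeroʳ b)
  eval-* ((a , k) ∷ p) b φ = begin
    a K.* (b K.* φ k) K.+ eval p (λ m → b K.* φ m)
      ≈⟨ K.+-cong (K.trans (K.sym (K.*-assoc _ _ _)) (K.trans (K.*-congʳ (K.*-comm a b)) (K.*-assoc _ _ _)))
           (eval-* p b φ) ⟩
    b K.* (a K.* φ k) K.+ b K.* eval p φ  ≈⟨ K.distribˡ b _ _ ⟨
    b K.* (a K.* φ k K.+ eval p φ)        ∎

  eval-comm : ∀ p q (F : Monomial → Monomial → K.Carrier) →
    eval p (λ k → eval q (λ l → F k l)) K.≈ eval q (λ l → eval p (λ k → F k l))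
  eval-comm []            q F = K.sym (eval-zero q)
  eval-comm ((a , k) ∷ p) q F = begin
    a K.* eval q (F k) K.+ eval p (λ k → eval q (F k))
      ≈⟨ K.+-cong (K.sym (eval-* q a (F k))) (eval-comm p q F) ⟩
    eval q (λ l → a K.* F k l) K.+ eval q (λ l → eval p (λ k → F k l))
      ≈⟨ eval-+ q _ _ ⟨
    eval q (λ l → a K.* F k l K.+ eval p (λ k → F k l)) ∎

  eval-term-* : ∀ a k q φ →
    eval (List.map (λ (b , l) → a K.* b , k *ᵐ l) q) φ K.≈ a K.* eval q (λ l → φ (k *ᵐ l))
  eval-term-* a k []            φ = K.sym (K.zeroʳ a)
  eval-term-* a k ((b , l) ∷ q) φ = K.trans
    (K.+-cong (K.*-assoc a b _) (eval-term-* a k q φ)) (K.sym (K.distribˡ a _ _))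

  eval-prod : ∀ p q φ → eval (p R₀.* q) φ K.≈ eval p (λ k → eval q (λ l → φ (k *ᵐ l)))
  eval-prod []            q φ = K.refl
  eval-prod ((a , k) ∷ p) q φ = K.trans
    (eval-++ (List.map (λ (b , l) → a K.* b , k *ᵐ l) q) (p R₀.* q) φ)
    (K.+-cong (eval-term-* a k q φ) (eval-prod p q φ))

  eval-neg : ∀ p φ → eval (R₀.- p) φ K.≈ K.- eval p φ
  eval-neg []            φ = K.sym K-Properties.-0#≈0#
  eval-neg ((a , k) ∷ p) φ = K.trans
    (K.+-cong (K.sym (K-Properties.-‿distribˡ-* a (φ k))) (eval-neg p φ))
    (K-Properties.-‿+-comm _ _)

  -- The ring laws are proved for all linear functionals eval _ φ at once, where they follow from
  -- linearity and Fubini; the coefficients are the functionals eval _ (δ m).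
  ≈-from-eval : ∀ p q → (∀ φ → eval p φ K.≈ eval q φ) → p R₀.≈ q
  ≈-from-eval p q eq m = K.trans (coeff-eval p m) (K.trans (eq (δ m)) (K.sym (coeff-eval q m)))

  eval-δ-*-divides : ∀ q {k m} → k ∣ᵐ m → eval q (λ l → δ m (k *ᵐ l)) K.≈ coeff q (m ÷ k)
  eval-δ-*-divides q {k} {m} k∣m = K.trans (eval-cong q agree) (K.sym (coeff-eval q (m ÷ k)))
    where
    agree : ∀ l → δ m (k *ᵐ l) K.≈ δ (m ÷ k) l
    agree l with l ≟ᵐ (m ÷ k)
    ... | yes l≡ = K.reflexive (δ-yes (≡.trans (≡.cong (k *ᵐ_) l≡) (*-÷ k∣m)))
    ... | no  l≢ = K.reflexive (δ-no (λ kl≡m → l≢ (≡.trans (≡.sym (÷-* k l)) (≡.cong (_÷ k) kl≡m))))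

  eval-δ-*-¬divides : ∀ q {k m} → ¬ (k ∣ᵐ m) → eval q (λ l → δ m (k *ᵐ l)) K.≈ K.0#
  eval-δ-*-¬divides q {k} {m} k∤m = K.trans
    (eval-cong q (λ l → K.reflexive (δ-no (λ kl≡m → k∤m (≡.subst (k ∣ᵐ_) kl≡m (∣-* k l))))))
    (eval-zero q)

  private
    prod-comm : ∀ p q → p R₀.* q R₀.≈ q R₀.* p
    prod-comm p q = ≈-from-eval (p R₀.* q) (q R₀.* p) λ φ → begin
      eval (p R₀.* q) φ                          ≈⟨ eval-prod p q φ ⟩
      eval p (λ k → eval q (λ l → φ (k *ᵐ l)))   ≈⟨ eval-comm p q _ ⟩
      eval q (λ l → eval p (λ k → φ (k *ᵐ l)))
        ≈⟨ eval-cong q (λ l → eval-cong p (λ k → K.reflexive (≡.cong φ (*ᵐ-comm k l)))) ⟩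
      eval q (λ l → eval p (λ k → φ (l *ᵐ k)))   ≈⟨ eval-prod q p φ ⟨
      eval (q R₀.* p) φ                          ∎

    prod-assoc : ∀ p q r → (p R₀.* q) R₀.* r R₀.≈ p R₀.* (q R₀.* r)
    prod-assoc p q r = ≈-from-eval ((p R₀.* q) R₀.* r) (p R₀.* (q R₀.* r)) λ φ → begin
      eval ((p R₀.* q) R₀.* r) φ                  ≈⟨ eval-prod (p R₀.* q) r φ ⟩
      eval (p R₀.* q) (λ k → eval r (λ l → φ (k *ᵐ l)))   ≈⟨ eval-prod p q _ ⟩
      eval p (λ j → eval q (λ k → eval r (λ l → φ ((j *ᵐ k) *ᵐ l))))
        ≈⟨ eval-cong p (λ j → eval-cong q (λ k → eval-cong r (λ l →
             K.reflexive (≡.cong φ (*ᵐ-assoc j k l))))) ⟩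
      eval p (λ j → eval q (λ k → eval r (λ l → φ (j *ᵐ (k *ᵐ l)))))
        ≈⟨ eval-cong p (λ j → K.sym (eval-prod q r _)) ⟩
      eval p (λ j → eval (q R₀.* r) (λ k → φ (j *ᵐ k)))   ≈⟨ eval-prod p (q R₀.* r) φ ⟨
      eval (p R₀.* (q R₀.* r)) φ  ∎

    -- Here q ≈ r compares coefficients only, so arbitrary functionals are of no help. The
    -- coefficient of m in k q is that of m ÷ k in q if k divides m, and 0 otherwise.
    prod-congˡ : ∀ p q r → q R₀.≈ r → p R₀.* q R₀.≈ p R₀.* r
    prod-congˡ p q r q≈r m = begin
      coeff (p R₀.* q) m                          ≈⟨ coeff-eval (p R₀.* q) m ⟩
      eval (p R₀.* q) (δ m)                       ≈⟨ eval-prod p q (δ m) ⟩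
      eval p (λ k → eval q (λ l → δ m (k *ᵐ l)))  ≈⟨ eval-cong p shift ⟩
      eval p (λ k → eval r (λ l → δ m (k *ᵐ l)))  ≈⟨ eval-prod p r (δ m) ⟨
      eval (p R₀.* r) (δ m)                       ≈⟨ coeff-eval (p R₀.* r) m ⟨
      coeff (p R₀.* r) m                          ∎
      where
      shift : ∀ k → eval q (λ l → δ m (k *ᵐ l)) K.≈ eval r (λ l → δ m (k *ᵐ l))
      shift k with k ∣ᵐ? m
      ... | yes k∣m = K.trans (eval-δ-*-divides q k∣m)
                        (K.trans (q≈r (m ÷ k)) (K.sym (eval-δ-*-divides r k∣m)))
      ... | no  k∤m = K.trans (eval-δ-*-¬divides q k∤m) (K.sym (eval-δ-*-¬divides r k∤m))

    prod-cong : ∀ p q r s → p R₀.≈ q → r R₀.≈ s → p R₀.* r R₀.≈ q R₀.* s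
    prod-cong p q r s p≈q r≈s m = begin
      coeff (p R₀.* r) m  ≈⟨ prod-congˡ p r s r≈s m ⟩
      coeff (p R₀.* s) m  ≈⟨ prod-comm p s m ⟩
      coeff (s R₀.* p) m  ≈⟨ prod-congˡ s p q p≈q m ⟩
      coeff (s R₀.* q) m  ≈⟨ prod-comm s q m ⟩
      coeff (q R₀.* s) m  ∎

    prod-identityˡ : ∀ p → R₀.1# R₀.* p R₀.≈ p
    prod-identityˡ p = ≈-from-eval (R₀.1# R₀.* p) p λ φ → begin
      eval (R₀.1# R₀.* p) φ                            ≈⟨ eval-prod R₀.1# p φ ⟩
      K.1# K.* eval p (λ l → φ (1ᵐ *ᵐ l)) K.+ K.0#     ≈⟨ K.+-identityʳ _ ⟩
      K.1# K.* eval p (λ l → φ (1ᵐ *ᵐ l))              ≈⟨ K.*-identityˡ _ ⟩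
      eval p (λ l → φ (1ᵐ *ᵐ l))
        ≈⟨ eval-cong p (λ l → K.reflexive (≡.cong φ (*ᵐ-identityˡ l))) ⟩
      eval p φ  ∎

    prod-distribʳ : ∀ p q r → (q R₀.+ r) R₀.* p R₀.≈ (q R₀.* p) R₀.+ (r R₀.* p)
    prod-distribʳ p q r = ≈-from-eval ((q R₀.+ r) R₀.* p) ((q R₀.* p) R₀.+ (r R₀.* p)) λ φ → begin
      eval ((q R₀.+ r) R₀.* p) φ                         ≈⟨ eval-prod (q R₀.+ r) p φ ⟩
      eval (q R₀.+ r) (λ k → eval p (λ l → φ (k *ᵐ l)))  ≈⟨ eval-++ q r _ ⟩
      eval q (λ k → eval p (λ l → φ (k *ᵐ l))) K.+ eval r (λ k → eval p (λ l → φ (k *ᵐ l)))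
        ≈⟨ K.+-cong (eval-prod q p φ) (eval-prod r p φ) ⟨
      eval (q R₀.* p) φ K.+ eval (r R₀.* p) φ            ≈⟨ eval-++ (q R₀.* p) (r R₀.* p) φ ⟨
      eval ((q R₀.* p) R₀.+ (r R₀.* p)) φ ∎

  coeff-++ : ∀ p q m → coeff (p ++ q) m K.≈ coeff p m K.+ coeff q m
  coeff-++ p q m = K.trans (coeff-eval (p ++ q) m)
    (K.trans (eval-++ p q (δ m)) (K.sym (K.+-cong (coeff-eval p m) (coeff-eval q m))))

  coeff-neg : ∀ p m → coeff (R₀.- p) m K.≈ K.- coeff p m
  coeff-neg p m = K.trans (coeff-eval (R₀.- p) m)
    (K.trans (eval-neg p (δ m)) (K.sym (K.-‿cong (coeff-eval p m))))

  private
    sum-inverseˡ : ∀ p → (R₀.- p) R₀.+ p R₀.≈ R₀.0#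
    sum-inverseˡ p m = K.trans (coeff-++ (R₀.- p) p m)
      (K.trans (K.+-congʳ (coeff-neg p m)) (K.-‿inverseˡ _))

    sum-comm : ∀ p q → p R₀.+ q R₀.≈ q R₀.+ p
    sum-comm p q m = K.trans (coeff-++ p q m)
      (K.trans (K.+-comm _ _) (K.sym (coeff-++ q p m)))

    sum-cong : ∀ p q r s → p R₀.≈ q → r R₀.≈ s → p R₀.+ r R₀.≈ q R₀.+ s
    sum-cong p q r s p≈q r≈s m = K.trans (coeff-++ p r m)
      (K.trans (K.+-cong (p≈q m) (r≈s m)) (K.sym (coeff-++ q s m)))

    sum-assoc : ∀ p q r → (p R₀.+ q) R₀.+ r R₀.≈ p R₀.+ (q R₀.+ r)
    sum-assoc p q r m = K.reflexive (≡.cong (λ x → coeff x m) (++-assoc p q r))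

    R-trans : ∀ p q r → p R₀.≈ q → q R₀.≈ r → p R₀.≈ r
    R-trans p q r p≈q q≈r m = K.trans (p≈q m) (q≈r m)

  R : CommutativeRing c ℓ₁
  R = record
    { Carrier = Poly
    ; _≈_ = R₀._≈_
    ; _+_ = R₀._+_
    ; _*_ = R₀._*_
    ; -_  = R₀.-_
    ; 0#  = R₀.0#
    ; 1#  = R₀.1#
    ; isCommutativeRing = record
      { isRing = record
        { +-isAbelianGroup = record
          { isGroup = record
            { isMonoid = record
              { isSemigroup = record
                { isMagma = record
                  { isEquivalence = record
                    { refl = λ m → K.refl
                    ; sym = λ p≈q m → K.sym (p≈q m)
                    ; trans = λ {p} {q} {r} → R-trans p q r
                    }
                  ; ∙-cong = λ {p} {q} {r} {s} → sum-cong p q r s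
                  }
                ; assoc = sum-assoc
                }
              ; identity = (λ p m → K.refl) , λ p → R-trans (p R₀.+ R₀.0#) p p (sum-comm p R₀.0#) (λ m → K.refl)
              }
            ; inverse = sum-inverseˡ , λ p →
                R-trans (p R₀.+ (R₀.- p)) ((R₀.- p) R₀.+ p) R₀.0# (sum-comm p (R₀.- p)) (sum-inverseˡ p)
            ; ⁻¹-cong = λ {p} {q} p≈q m →
                K.trans (coeff-neg p m) (K.trans (K.-‿cong (p≈q m)) (K.sym (coeff-neg q m)))
            }
          ; comm = sum-comm
          }
        ; *-cong = λ {p} {q} {r} {s} → prod-cong p q r s
        ; *-assoc = prod-assoc
        ; *-identity = prod-identityˡ , λ p →
            R-trans (p R₀.* R₀.1#) (R₀.1# R₀.* p) p (prod-comm p R₀.1#) (prod-identityˡ p)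
        ; distrib =
            (λ p q r → R-trans (p R₀.* (q R₀.+ r)) ((q R₀.+ r) R₀.* p) ((p R₀.* q) R₀.+ (p R₀.* r))
              (prod-comm p (q R₀.+ r))
              (R-trans ((q R₀.+ r) R₀.* p) ((q R₀.* p) R₀.+ (r R₀.* p)) ((p R₀.* q) R₀.+ (p R₀.* r))
                (prod-distribʳ p q r)
                (sum-cong (q R₀.* p) (p R₀.* q) (r R₀.* p) (p R₀.* r) (prod-comm q p) (prod-comm r p))))
          , prod-distribʳ
        }
      ; *-comm = prod-comm
      }
    }

  module R = CommutativeRing R

  coeff-monomial-* : ∀ u p m → coeff (monomial u R.* p) (u *ᵐ m) K.≈ coeff p m
  coeff-monomial-* u p m = begin
    coeff (monomial u R.* p) (u *ᵐ m)        ≈⟨ coeff-eval (monomial u R.* p) (u *ᵐ m) ⟩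
    eval (monomial u R.* p) (δ (u *ᵐ m))     ≈⟨ eval-prod (monomial u) p _ ⟩
    K.1# K.* eval p (λ l → δ (u *ᵐ m) (u *ᵐ l)) K.+ K.0#  ≈⟨ K.+-identityʳ _ ⟩
    K.1# K.* eval p (λ l → δ (u *ᵐ m) (u *ᵐ l))           ≈⟨ K.*-identityˡ _ ⟩
    eval p (λ l → δ (u *ᵐ m) (u *ᵐ l))       ≈⟨ eval-δ-*-divides p (∣-* u m) ⟩
    coeff p ((u *ᵐ m) ÷ u)                   ≈⟨ K.reflexive (≡.cong (coeff p) (÷-* u m)) ⟩
    coeff p m                                ∎

  coeff-monomial-*-¬divides : ∀ {u m} p → ¬ (u ∣ᵐ m) → coeff (monomial u R.* p) m K.≈ K.0#
  coeff-monomial-*-¬divides {u} {m} p u∤m = begin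
    coeff (monomial u R.* p) m        ≈⟨ coeff-eval (monomial u R.* p) m ⟩
    eval (monomial u R.* p) (δ m)     ≈⟨ eval-prod (monomial u) p _ ⟩
    K.1# K.* eval p (λ l → δ m (u *ᵐ l)) K.+ K.0#  ≈⟨ K.+-identityʳ _ ⟩
    K.1# K.* eval p (λ l → δ m (u *ᵐ l))           ≈⟨ K.*-identityˡ _ ⟩
    eval p (λ l → δ m (u *ᵐ l))       ≈⟨ eval-δ-*-¬divides p u∤m ⟩
    K.0#                              ∎

  constant : Poly → K.Carrier
  constant p = coeff p 1ᵐ

  -- A product of monomials is 1 only if both factors are, so `δ 1ᵐ` is multiplicative on monomials.
  constant-* : ∀ p q → constant (p R.* q) K.≈ constant p K.* constant q
  constant-* p q = begin
    constant (p R.* q)                           ≈⟨ coeff-eval (p R.* q) 1ᵐ ⟩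
    eval (p R.* q) (δ 1ᵐ)                        ≈⟨ eval-prod p q (δ 1ᵐ) ⟩
    eval p (λ k → eval q (λ l → δ 1ᵐ (k *ᵐ l)))
      ≈⟨ eval-cong p (λ k → eval-cong q (λ l → δ-* k l)) ⟩
    eval p (λ k → eval q (λ l → δ 1ᵐ k K.* δ 1ᵐ l))
      ≈⟨ eval-cong p (λ k → eval-* q (δ 1ᵐ k) (δ 1ᵐ)) ⟩
    eval p (λ k → δ 1ᵐ k K.* eval q (δ 1ᵐ))
      ≈⟨ eval-cong p (λ k → K.*-comm _ _) ⟩
    eval p (λ k → eval q (δ 1ᵐ) K.* δ 1ᵐ k)      ≈⟨ eval-* p _ _ ⟩
    eval q (δ 1ᵐ) K.* eval p (δ 1ᵐ)              ≈⟨ K.*-comm _ _ ⟩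
    eval p (δ 1ᵐ) K.* eval q (δ 1ᵐ)              ≈⟨ K.*-cong (coeff-eval p 1ᵐ) (coeff-eval q 1ᵐ) ⟨
    constant p K.* constant q                    ∎
    where
    δ-* : ∀ k l → δ 1ᵐ (k *ᵐ l) K.≈ δ 1ᵐ k K.* δ 1ᵐ l
    δ-* k l with k ≟ᵐ 1ᵐ
    ... | no k≢1 = K.trans (K.reflexive (δ-no (λ kl≡1 → k≢1 (1-factorˡ k l kl≡1)))) (K.sym (K.zeroˡ _))
    ... | yes ≡.refl = K.trans (K.reflexive (≡.cong (δ 1ᵐ) (*ᵐ-identityˡ l))) (K.sym (K.*-identityˡ _))

  coeff-monomial-≡ : ∀ {u m} → u ≡ m → coeff (monomial u) m K.≈ K.1#
  coeff-monomial-≡ {u} {m} u≡m rewrite dec-true (u ≟ᵐ m) u≡m = K.+-identityʳ _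

  coeff-monomial-≢ : ∀ {u m} → u ≢ m → coeff (monomial u) m K.≈ K.0#
  coeff-monomial-≢ {u} {m} u≢m rewrite dec-false (u ≟ᵐ m) u≢m = K.refl

-- Monomial ideals

module MonomialIdeals {c ℓ₁ ℓ₂} (𝕂 : HeytingField c ℓ₁ ℓ₂) (n : ℕ) where
  open PolynomialRing 𝕂 n
  open LinearAlgebra polynomialRing using (sum)
  open SetoidReasoning K.setoid

  -- Homogeneous components and ideals described by their monomials

  filter : ∀ {p} {P : Pred Monomial p} → Decidable P → Poly → Poly
  filter P? []            = []
  filter P? ((a , k) ∷ f) = if does (P? k) then (a , k) ∷ filter P? f else filter P? f

  module _ {p} {P : Pred Monomial p} (P? : Decidable P) where

    coeff-filter-yes : ∀ f {m} → P m → coeff (filter P? f) m K.≈ coeff f m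
    coeff-filter-yes []            Pm = K.refl
    coeff-filter-yes ((a , k) ∷ f) {m} Pm with P? k
    ... | yes Pk with k ≟ᵐ m
    ...   | yes _ = K.+-congˡ (coeff-filter-yes f Pm)
    ...   | no  _ = coeff-filter-yes f Pm
    coeff-filter-yes ((a , k) ∷ f) {m} Pm | no ¬Pk with k ≟ᵐ m
    ...   | yes ≡.refl = ⊥-elim (¬Pk Pm)
    ...   | no  _ = coeff-filter-yes f Pm

    coeff-filter-no : ∀ f {m} → ¬ P m → coeff (filter P? f) m K.≈ K.0#
    coeff-filter-no []            ¬Pm = K.refl
    coeff-filter-no ((a , k) ∷ f) {m} ¬Pm with P? k
    ... | no _ = coeff-filter-no f ¬Pm
    ... | yes Pk with k ≟ᵐ m
    ...   | yes ≡.refl = ⊥-elim (¬Pm Pk)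
    ...   | no  _ = coeff-filter-no f ¬Pm

    eval-filter : ∀ f φ →
      eval (filter P? f) φ K.≈ eval f (λ k → if does (P? k) then φ k else K.0#)
    eval-filter []            φ = K.refl
    eval-filter ((a , k) ∷ f) φ with P? k
    ... | yes _ = K.+-congˡ (eval-filter f φ)
    ... | no  _ = K.trans (eval-filter f φ)
                    (K.trans (K.sym (K.+-identityˡ _)) (K.+-congʳ (K.sym (K.zeroʳ a))))

  degree : Monomial → ℕ
  degree = Vec.sum

  private
    sum-zipWith : ∀ {n} (k l : Vec ℕ n) → Vec.sum (Vec.zipWith _+_ k l) ≡ Vec.sum k + Vec.sum l
    sum-zipWith []      []      = ≡.refl
    sum-zipWith (x ∷ k) (y ∷ l) = ≡.trans (≡.cong (λ z → x + y + z) (sum-zipWith k l))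
      (CommutativeSemigroupProperties.interchange ℕ.+-commutativeSemigroup x y (Vec.sum k) (Vec.sum l))

    sum-indicator : ∀ {n} (S : Subset n) → Vec.sum (Vec.map (λ s → if s then 1 else 0) S) ≡ ∣ S ∣
    sum-indicator []          = ≡.refl
    sum-indicator (true ∷ S)  = ≡.cong suc (sum-indicator S)
    sum-indicator (false ∷ S) = sum-indicator S

    sum-replicate-0 : ∀ n → Vec.sum (Vec.replicate n 0) ≡ 0
    sum-replicate-0 zero    = ≡.refl
    sum-replicate-0 (suc n) = sum-replicate-0 n

  degree-* : ∀ k l → degree (k *ᵐ l) ≡ degree k + degree l
  degree-* = sum-zipWith

  degree-𝐱 : ∀ S → degree (𝐱 S) ≡ ∣ S ∣
  degree-𝐱 = sum-indicator

  degree-1 : degree 1ᵐ ≡ 0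
  degree-1 = sum-replicate-0 n

  degree? : ∀ e → Decidable (λ k → degree k ≡ e)
  degree? e k = degree k ℕ.≟ e

  π : ℕ → Poly → Poly
  π e = filter (degree? e)

  private
    if-cong : ∀ {p q} {P : Set p} {Q : Set q} (P? : Dec P) (Q? : Dec Q) → (P → Q) → (Q → P) →
      ∀ {x y} → (P → x K.≈ y) →
      (if does P? then x else K.0#) K.≈ (if does Q? then y else K.0#)
    if-cong (yes p) (yes _) _   _   x≈y = x≈y p
    if-cong (yes p) (no ¬q) P⇒Q _   _   = ⊥-elim (¬q (P⇒Q p))
    if-cong (no ¬p) (yes q) _   Q⇒P _   = ⊥-elim (¬p (Q⇒P q))
    if-cong (no _)  (no _)  _   _   _   = K.refl

    -- For k of degree i, the product k l has degree i + j exactly when l has degree j, so the two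
    -- restrictions of a functional agree on such products.
    π-* : ∀ i j f g → π (i + j) (π i f R.* g) R.≈ π i f R.* π j g
    π-* i j f g = ≈-from-eval (π (i + j) (π i f R.* g)) (π i f R.* π j g) λ φ → begin
      eval (π (i + j) (π i f R.* g)) φ     ≈⟨ eval-filter (degree? (i + j)) (π i f R.* g) φ ⟩
      eval (π i f R.* g) (only (i + j) φ)  ≈⟨ eval-prod (π i f) g (only (i + j) φ) ⟩
      eval (π i f) (λ k → eval g (λ l → only (i + j) φ (k *ᵐ l)))
        ≈⟨ eval-filter (degree? i) f _ ⟩
      eval f (only i (λ k → eval g (λ l → only (i + j) φ (k *ᵐ l))))
        ≈⟨ eval-cong f (agree φ) ⟩
      eval f (only i (λ k → eval (π j g) (λ l → φ (k *ᵐ l))))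
        ≈⟨ eval-filter (degree? i) f _ ⟨
      eval (π i f) (λ k → eval (π j g) (λ l → φ (k *ᵐ l)))
        ≈⟨ eval-prod (π i f) (π j g) φ ⟨
      eval (π i f R.* π j g) φ ∎
      where
      only : ℕ → (Monomial → K.Carrier) → Monomial → K.Carrier
      only e φ k = if does (degree? e k) then φ k else K.0#
      agree : ∀ φ k → only i (λ k → eval g (λ l → only (i + j) φ (k *ᵐ l))) k
                K.≈ only i (λ k → eval (π j g) (λ l → φ (k *ᵐ l))) k
      agree φ k = if-cong (degree? i k) (degree? i k) (λ p → p) (λ p → p) λ { ≡.refl →
        K.trans (eval-cong g same) (K.sym (eval-filter (degree? j) g _)) }
        where
        same : ∀ l → only (degree k + j) φ (k *ᵐ l) K.≈ only j (λ l → φ (k *ᵐ l)) l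
        same l = if-cong (degree? (degree k + j) (k *ᵐ l)) (degree? j l)
          (λ eq → ℕ.+-cancelˡ-≡ (degree k) _ _ (≡.trans (≡.sym (degree-* k l)) eq))
          (λ eq → ≡.trans (degree-* k l) (≡.cong (degree k +_) eq))
          (λ _ → K.refl)

    π-cong : ∀ e {f g} → f R.≈ g → π e f R.≈ π e g
    π-cong e {f} {g} f≈g m with degree? e m
    ... | yes p = K.trans (coeff-filter-yes (degree? e) f p)
                    (K.trans (f≈g m) (K.sym (coeff-filter-yes (degree? e) g p)))
    ... | no ¬p = K.trans (coeff-filter-no (degree? e) f ¬p) (K.sym (coeff-filter-no (degree? e) g ¬p))

    π-+ : ∀ e f g → π e (f R.+ g) R.≈ π e f R.+ π e g
    π-+ e f g m with degree? e m
    ... | yes p = begin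
      coeff (π e (f R.+ g)) m                 ≈⟨ coeff-filter-yes (degree? e) (f R.+ g) p ⟩
      coeff (f R.+ g) m                       ≈⟨ coeff-++ f g m ⟩
      coeff f m K.+ coeff g m
        ≈⟨ K.+-cong (coeff-filter-yes (degree? e) f p) (coeff-filter-yes (degree? e) g p) ⟨
      coeff (π e f) m K.+ coeff (π e g) m     ≈⟨ coeff-++ (π e f) (π e g) m ⟨
      coeff (π e f R.+ π e g) m               ∎
    ... | no ¬p = begin
      coeff (π e (f R.+ g)) m                 ≈⟨ coeff-filter-no (degree? e) (f R.+ g) ¬p ⟩
      K.0#                                    ≈⟨ K.+-identityˡ _ ⟨
      K.0# K.+ K.0#
        ≈⟨ K.+-cong (coeff-filter-no (degree? e) f ¬p) (coeff-filter-no (degree? e) g ¬p) ⟨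
      coeff (π e f) m K.+ coeff (π e g) m     ≈⟨ coeff-++ (π e f) (π e g) m ⟨
      coeff (π e f R.+ π e g) m               ∎

  π-monomial : ∀ m → π (degree m) (monomial m) ≡ monomial m
  π-monomial m rewrite dec-true (degree? (degree m) m) ≡.refl = ≡.refl

  grading : Grading R
  grading = record
    { π = π
    ; π-cong = λ e {f} {g} → π-cong e {f} {g}
    ; π-+ = π-+
    ; π-* = π-*
    ; π-1 = λ m → K.reflexive (≡.cong (λ f → coeff f m)
        (≡.subst (λ e → π e (monomial 1ᵐ) ≡ monomial 1ᵐ) degree-1 (π-monomial 1ᵐ)))
    }

  -- Equality in 𝕂 need not be decidable, so a monomial ideal is handled through the vanishing of
  -- coefficients outside the up-closed set U of its monomials, which is decidable.
  ⟦_⟧ : ∀ {u} → Pred Monomial u → Pred Poly _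
  ⟦ U ⟧ f = ∀ m → ¬ U m → coeff f m K.≈ K.0#

  ⟦⟧-mono : ∀ {u v} {U : Pred Monomial u} {V : Pred Monomial v} →
            (∀ m → U m → V m) → ∀ f → ⟦ U ⟧ f → ⟦ V ⟧ f
  ⟦⟧-mono U⇒V f f∈U m m∉V = f∈U m (m∉V ∘ U⇒V m)

  ⟦⟧-cong : ∀ {u} {U : Pred Monomial u} f g → f R.≈ g → ⟦ U ⟧ f → ⟦ U ⟧ g
  ⟦⟧-cong f g f≈g f∈U m m∉U = K.trans (K.sym (f≈g m)) (f∈U m m∉U)

  monomial∈ : ∀ {u} {U : Pred Monomial u} {m} → U m → ⟦ U ⟧ (monomial m)
  monomial∈ {m = m} m∈U k k∉U = coeff-monomial-≢ {m} {k} λ { ≡.refl → k∉U m∈U }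

  -- If m were outside `U`, its coefficient 1 would have to vanish, against `1≉0`. Decidability of
  -- `U` turns this refutation into membership.
  monomial∈⁻¹ : ∀ {u} {U : Pred Monomial u} → Decidable U → ∀ {m} → ⟦ U ⟧ (monomial m) → U m
  monomial∈⁻¹ U? {m} m∈ with U? m
  ... | yes m∈U = m∈U
  ... | no  m∉U = ⊥-elim (1≉0 (K.trans (K.sym (coeff-monomial-≡ {m} ≡.refl)) (m∈ m m∉U)))

  Multiples : {J : Set} → (J → Monomial) → Pred Monomial _
  Multiples g m = ∃[ j ] g j ∣ᵐ m

  module _ {J : Set} (g : J → Monomial) where

    span⇒⟦⟧ : ∀ f → ⟨ (λ j → monomial (g j)) ⟩ f → ⟦ Multiples g ⟧ f
    span⇒⟦⟧ f (k , h , j , f≈) m m∉ = K.trans (f≈ m) (vanishes k h j)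
      where
      vanishes : ∀ k (h : Vector Poly k) (j : Vector J k) →
                 coeff (sum (λ i → h i R.* monomial (g (j i)))) m K.≈ K.0#
      vanishes zero    h j = K.refl
      vanishes (suc k) h j = begin
        coeff (h zero R.* u R.+ rest) m        ≈⟨ coeff-++ (h zero R.* u) rest m ⟩
        coeff (h zero R.* u) m K.+ coeff rest m
          ≈⟨ K.+-cong (R.*-comm (h zero) u m) (vanishes k (h ∘ suc) (j ∘ suc)) ⟩
        coeff (u R.* h zero) m K.+ K.0#        ≈⟨ K.+-identityʳ _ ⟩
        coeff (u R.* h zero) m                 ≈⟨ coeff-monomial-*-¬divides (h zero) (λ d → m∉ (j zero , d)) ⟩
        K.0#                                   ∎
        where
        u    = monomial (g (j zero))
        rest = sum (λ i → h (suc i) R.* monomial (g (j (suc i))))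

    -- The list f may contain terms outside the ideal that cancel each other, so it cannot be
    -- converted term by term. `multiples` keeps only the terms that are multiples of generators,
    -- which settles the coefficients at such monomials; at all others both sides vanish, f by
    -- hypothesis and the combination by `span⇒⟦⟧`.
    ⟦⟧⇒span : Decidable (Multiples g) → ∀ f → ⟦ Multiples g ⟧ f → ⟨ (λ j → monomial (g j)) ⟩ f
    ⟦⟧⇒span U? f f∈ with multiples f
      where
      Combination : Poly → Set _
      Combination f = ∃[ k ] Σ (Vector Poly k) λ h → Σ (Vector J k) λ j → ∀ m → Multiples g m →
        coeff f m K.≈ coeff (sum (λ i → h i R.* monomial (g (j i)))) m
      multiples : ∀ f → Combination f
      multiples [] = 0 , (λ ()) , (λ ()) , λ m _ → K.refl
      multiples ((a , k) ∷ f) with multiples f | U? k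
      ... | N , h , j , eq | no k∉ = N , h , j , λ m m∈ → skip m m∈
        where
        skip : ∀ m → Multiples g m → coeff ((a , k) ∷ f) m K.≈ _
        skip m m∈ with k ≟ᵐ m
        ... | yes ≡.refl = ⊥-elim (k∉ m∈)
        ... | no  _ = eq m m∈
      ... | N , h , j , eq | yes (j₀ , d) =
        suc N , ((a , k ÷ g j₀) ∷ []) Functional.∷ h , j₀ Functional.∷ j , λ m m∈ → add m m∈
        where
        term : (k ÷ g j₀) *ᵐ g j₀ ≡ k
        term = ≡.trans (*ᵐ-comm (k ÷ g j₀) (g j₀)) (*-÷ d)
        add : ∀ m → Multiples g m → coeff ((a , k) ∷ f) m K.≈
              coeff ((a K.* K.1# , (k ÷ g j₀) *ᵐ g j₀) ∷ sum (λ i → h i R.* monomial (g (j i)))) m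
        add m m∈ rewrite term with k ≟ᵐ m
        ... | yes _ = K.+-cong (K.sym (K.*-identityʳ a)) (eq m m∈)
        ... | no  _ = eq m m∈
    ... | k , h , j , eq = k , h , j , all
      where
      all : f R.≈ sum (λ i → h i R.* monomial (g (j i)))
      all m with U? m
      ... | yes m∈ = eq m m∈
      ... | no  m∉ = K.trans (f∈ m m∉) (K.sym (span⇒⟦⟧ (sum (λ i → h i R.* monomial (g (j i))))
                             (k , h , j , λ _ → K.refl) m m∉))

  module _ {u} {U : Pred Monomial u} (x : Monomial) where

    colon⇒ : ∀ f → ⟦ U ⟧ (monomial x R.* f) → ⟦ (λ m → U (x *ᵐ m)) ⟧ f
    colon⇒ f xf∈ m xm∉ = K.trans (K.sym (coeff-monomial-* x f m)) (xf∈ (x *ᵐ m) xm∉)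

    colon⇐ : ∀ f → ⟦ (λ m → U (x *ᵐ m)) ⟧ f → ⟦ U ⟧ (monomial x R.* f)
    colon⇐ f f∈ m m∉ with x ∣ᵐ? m
    ... | no  x∤m = coeff-monomial-*-¬divides f x∤m
    ... | yes x∣m = ≡.subst (λ k → coeff (monomial x R.* f) k K.≈ K.0#) (*-÷ x∣m)
      (K.trans (coeff-monomial-* x f (m ÷ x))
        (f∈ (m ÷ x) (λ k∈ → m∉ (≡.subst U (*-÷ x∣m) k∈))))

  quotient : Monomial → Poly → Poly
  quotient x []            = []
  quotient x ((a , k) ∷ f) = if does (x ∣ᵐ? k) then (a , k ÷ x) ∷ quotient x f else quotient x f

  coeff-quotient : ∀ x f m → coeff (quotient x f) m K.≈ coeff f (x *ᵐ m)
  coeff-quotient x []            m = K.refl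
  coeff-quotient x ((a , k) ∷ f) m with x ∣ᵐ? k | k ≟ᵐ (x *ᵐ m)
  ... | yes x∣k | yes k≡ rewrite dec-true ((k ÷ x) ≟ᵐ m) (≡.trans (≡.cong (_÷ x) k≡) (÷-* x m)) =
    K.+-congˡ (coeff-quotient x f m)
  ... | yes x∣k | no  k≢ rewrite dec-false ((k ÷ x) ≟ᵐ m)
                    (λ eq → k≢ (≡.trans (≡.sym (*-÷ x∣k)) (≡.cong (x *ᵐ_) eq))) =
    coeff-quotient x f m
  ... | no  x∤k | yes k≡ = ⊥-elim (x∤k (≡.subst (x ∣ᵐ_) (≡.sym k≡) (∣-* x m)))
  ... | no  x∤k | no  k≢ = coeff-quotient x f m

  *-quotient : ∀ x f → ⟦ (x ∣ᵐ_) ⟧ f → f R.≈ monomial x R.* quotient x f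
  *-quotient x f f∈ m with x ∣ᵐ? m
  ... | no  x∤m = K.trans (f∈ m x∤m) (K.sym (coeff-monomial-*-¬divides (quotient x f) x∤m))
  ... | yes x∣m = ≡.subst (λ k → coeff f k K.≈ coeff (monomial x R.* quotient x f) k) (*-÷ x∣m)
    (K.sym (K.trans (coeff-monomial-* x (quotient x f) (m ÷ x)) (coeff-quotient x f (m ÷ x))))

  module _ {u} {U : Pred Monomial u} (U? : Decidable U) (x : Monomial) where

    -- `g` collects the terms of f in `U`. What is left has coefficient 0 at every monomial not
    -- divisible by x, so it can be divided by x.
    add-generator⇒ : ∀ f → ⟦ (λ m → U m ⊎ x ∣ᵐ m) ⟧ f →
                     ∃[ g ] ∃[ h ] ⟦ U ⟧ g × f R.≈ g R.+ monomial x R.* h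
    add-generator⇒ f f∈ = g , quotient x rest , (λ m → coeff-filter-no U? f) , split
      where
      g rest : Poly
      g = filter U? f
      rest = f R.+ (R.- g)
      coeff-rest : ∀ m → coeff rest m K.≈ coeff f m K.+ K.- coeff g m
      coeff-rest m = K.trans (coeff-++ f (R.- g) m) (K.+-congˡ (coeff-neg g m))
      rest∈ : ⟦ (x ∣ᵐ_) ⟧ rest
      rest∈ m x∤m with U? m
      ... | yes m∈U = K.trans (coeff-rest m)
        (K.trans (K.+-congˡ (K.-‿cong (coeff-filter-yes U? f m∈U))) (K.-‿inverseʳ _))
      ... | no  m∉U = K.trans (coeff-rest m) (K.trans
        (K.+-cong (f∈ m λ { (inj₁ m∈U) → m∉U m∈U ; (inj₂ x∣m) → x∤m x∣m })
          (K.trans (K.-‿cong (coeff-filter-no U? f m∉U)) K-Properties.-0#≈0#))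
        (K.+-identityˡ _))
      split : f R.≈ g R.+ monomial x R.* quotient x rest
      split m = begin
        coeff f m                               ≈⟨ K.+-identityʳ _ ⟨
        coeff f m K.+ K.0#                      ≈⟨ K.+-congˡ (K.-‿inverseˡ _) ⟨
        coeff f m K.+ (K.- coeff g m K.+ coeff g m)  ≈⟨ K.+-assoc _ _ _ ⟨
        (coeff f m K.+ K.- coeff g m) K.+ coeff g m  ≈⟨ K.+-comm _ _ ⟩
        coeff g m K.+ (coeff f m K.+ K.- coeff g m)  ≈⟨ K.+-congˡ (coeff-rest m) ⟨
        coeff g m K.+ coeff rest m              ≈⟨ K.+-congˡ (*-quotient x rest rest∈ m) ⟩
        coeff g m K.+ coeff (monomial x R.* quotient x rest) m
          ≈⟨ coeff-++ g (monomial x R.* quotient x rest) m ⟨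
        coeff (g R.+ monomial x R.* quotient x rest) m ∎

    add-generator⇐ : ∀ f → (∃[ g ] ∃[ h ] ⟦ U ⟧ g × f R.≈ g R.+ monomial x R.* h) →
                     ⟦ (λ m → U m ⊎ x ∣ᵐ m) ⟧ f
    add-generator⇐ f (g , h , g∈ , f≈) m m∉ = begin
      coeff f m                                    ≈⟨ f≈ m ⟩
      coeff (g R.+ monomial x R.* h) m             ≈⟨ coeff-++ g (monomial x R.* h) m ⟩
      coeff g m K.+ coeff (monomial x R.* h) m
        ≈⟨ K.+-cong (g∈ m (m∉ ∘ inj₁)) (coeff-monomial-*-¬divides h (m∉ ∘ inj₂)) ⟩
      K.0# K.+ K.0#                                ≈⟨ K.+-identityˡ _ ⟩
      K.0#                                         ∎

-- Resolutions from linear quotients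

∣p-x∣ : ∀ {n} {p : Subset n} {x} → x ∈ p → suc ∣ p - x ∣ ≡ ∣ p ∣
∣p-x∣ {p = inside ∷ p}  here        = ≡.cong (suc ∘ ∣_∣) (p─⊥≡p p)
∣p-x∣ {p = inside ∷ p}  (there x∈p) = ≡.cong suc (∣p-x∣ x∈p)
∣p-x∣ {p = outside ∷ p} (there x∈p) = ∣p-x∣ x∈p

x∈p─q⇒x∉q : ∀ {n} (p q : Subset n) {x} → x ∈ p ─ q → x ∉ q
x∈p─q⇒x∉q (inside ∷ p) (outside ∷ q) here          ()
x∈p─q⇒x∉q (_ ∷ p)      (outside ∷ q) (there x∈p─q) (there x∈q) = x∈p─q⇒x∉q p q x∈p─q x∈q
x∈p─q⇒x∉q (_ ∷ p)      (inside ∷ q)  (there x∈p─q) (there x∈q) = x∈p─q⇒x∉q p q x∈p─q x∈q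

-- The ranks in positive degrees of the Koszul complex on k elements: aug (kosz k) i = binomial k i.
kosz : ℕ → ℕ → ℕ
kosz zero    i = 0
kosz (suc k) i = kosz k i + aug (kosz k) i

kosz-zero : ∀ k i → k < i → aug (kosz k) i ≡ 0
kosz-zero zero    (suc i) k<i       = ≡.refl
kosz-zero (suc k) (suc i) (s≤s k<i) =
  ≡.cong₂ _+_ (kosz-zero k (suc i) (ℕ.m<n⇒m<1+n k<i)) (kosz-zero k i k<i)

kosz-zero⁻¹ : ∀ k i → aug (kosz k) i ≡ 0 → k < i
kosz-zero⁻¹ zero    (suc i) _  = s≤s z≤n
kosz-zero⁻¹ (suc k) (suc i) eq = s≤s (kosz-zero⁻¹ k i (ℕ.m+n≡0⇒n≡0 (kosz k i) eq))

module LinearQuotients {c ℓ₁ ℓ₂} (𝕂 : HeytingField c ℓ₁ ℓ₂) (n : ℕ) where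
  open PolynomialRing 𝕂 n
  open MonomialIdeals 𝕂 n
  open GradedMaps R grading

  Supp : Monomial → Pred (Fin n) _
  Supp m i = 1 ≤ Vec.lookup m i

  private
    𝐱∣⇒′ : ∀ {n} (S : Subset n) (m : Vec ℕ n) → Pointwise _≤_ (Vec.map (λ s → if s then 1 else 0) S) m →
            ∀ {i} → i ∈ S → 1 ≤ Vec.lookup m i
    𝐱∣⇒′ (true ∷ S) (x ∷ m) (p ∷ _)  here      = p
    𝐱∣⇒′ (_ ∷ S)    (x ∷ m) (_ ∷ ps) (there i∈S) = 𝐱∣⇒′ S m ps i∈S

    𝐱∣⇐′ : ∀ {n} (S : Subset n) (m : Vec ℕ n) → (∀ {i} → i ∈ S → 1 ≤ Vec.lookup m i) →
            Pointwise _≤_ (Vec.map (λ s → if s then 1 else 0) S) m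
    𝐱∣⇐′ []          []      h = []
    𝐱∣⇐′ (true ∷ S)  (x ∷ m) h = h here ∷ 𝐱∣⇐′ S m (h ∘ there)
    𝐱∣⇐′ (false ∷ S) (x ∷ m) h = z≤n ∷ 𝐱∣⇐′ S m (h ∘ there)

    supp-𝐱⇒′ : ∀ {n} (S : Subset n) i → 1 ≤ Vec.lookup (Vec.map (λ s → if s then 1 else 0) S) i → i ∈ S
    supp-𝐱⇒′ (true ∷ S)  zero    p = here
    supp-𝐱⇒′ (_ ∷ S)     (suc i) p = there (supp-𝐱⇒′ S i p)

  𝐱∣⇒ : ∀ {S m} → 𝐱 S ∣ᵐ m → ∀ {i} → i ∈ S → Supp m i
  𝐱∣⇒ {S} {m} = 𝐱∣⇒′ S m

  𝐱∣⇐ : ∀ {S m} → (∀ {i} → i ∈ S → Supp m i) → 𝐱 S ∣ᵐ m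
  𝐱∣⇐ {S} {m} = 𝐱∣⇐′ S m

  supp-𝐱⇒ : ∀ {S i} → Supp (𝐱 S) i → i ∈ S
  supp-𝐱⇒ {S} {i} = supp-𝐱⇒′ S i

  supp-𝐱⇐ : ∀ {S i} → i ∈ S → Supp (𝐱 S) i
  supp-𝐱⇐ {S} = 𝐱∣⇒ {S} {𝐱 S} ∣ᵐ-refl

  supp-*⇒ : ∀ {k l i} → Supp (k *ᵐ l) i → Supp k i ⊎ Supp l i
  supp-*⇒ {k} {l} {i} p with Vec.lookup k i in eq
  ... | zero  = inj₂ (≡.subst (1 ≤_) (≡.trans (Vec.lookup-zipWith _+_ i k l) (≡.cong (_+ Vec.lookup l i) eq)) p)
  ... | suc _ = inj₁ (s≤s z≤n)

  supp-*⇐ˡ : ∀ {k l i} → Supp k i → Supp (k *ᵐ l) i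
  supp-*⇐ˡ {k} {l} {i} p = ≡.subst (1 ≤_) (≡.sym (Vec.lookup-zipWith _+_ i k l)) (ℕ.≤-trans p (ℕ.m≤m+n _ _))

  supp-*⇐ʳ : ∀ {k l i} → Supp l i → Supp (k *ᵐ l) i
  supp-*⇐ʳ {k} {l} {i} p =
    ≡.subst (1 ≤_) (≡.sym (Vec.lookup-zipWith _+_ i k l)) (ℕ.≤-trans p (ℕ.m≤n+m _ (Vec.lookup k i)))

  Vars : Subset n → Pred Monomial _
  Vars A = Multiples (λ ((i , _) : ∃ (_∈ A)) → 𝐱 ⁅ i ⁆)

  vars : ∀ {A m i} → i ∈ A → Supp m i → Vars A m
  vars {m = m} {i} i∈A p = (i , i∈A) , 𝐱∣⇐ λ j∈ → ≡.subst (Supp m) (≡.sym (x∈⁅y⁆⇒x≡y i j∈)) p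

  vars⁻¹ : ∀ {A m} → Vars A m → ∃[ i ] i ∈ A × Supp m i
  vars⁻¹ ((i , i∈A) , d) = i , i∈A , 𝐱∣⇒ d (x∈⁅x⁆ i)

  Vars? : ∀ A → Decidable (Vars A)
  Vars? A m = map′ (λ (i , i∈A , p) → vars i∈A p) vars⁻¹
    (Fin.any? (λ i → (i ∈? A) ×-dec (1 ℕ.≤? Vec.lookup m i)))

  transport : ∀ {p q e r} {I : Pred Poly p} {J : Pred Poly q} → (∀ f → I f → J f) → (∀ f → J f → I f) →
              LinearResolution e r I → LinearResolution e r J
  transport I⇒J J⇒I F = record
    { acyclic = acyclic
    ; graded  = graded
    ; image   = λ f Jf → image f (J⇒I f Jf)
    ; image⁻¹ = λ f im → I⇒J f (image⁻¹ f im)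
    }
    where open LinearResolution F

  π-monomial-≈ : ∀ {e} u → degree u ≡ e → π e (monomial u) R.≈ monomial u
  π-monomial-≈ u ≡.refl m = K.reflexive (≡.cong (λ f → coeff f m) (π-monomial u))

  -- One mapping cone in terms of monomials: the first two inclusions say that U : x is generated by
  -- the variables in A, the last two that V arises from U by adding x. It serves both the Koszul
  -- complex and linear quotients.
  add-generator : ∀ {u v e r k} {U : Pred Monomial u} {V : Pred Monomial v} (U? : Decidable U) A x →
    LinearResolution e r ⟦ U ⟧ → LinearResolution 1 (kosz k) ⟦ Vars A ⟧ → degree x ≡ e →
    (∀ m → Vars A m → U (x *ᵐ m)) → (∀ m → U (x *ᵐ m) → Vars A m) →
    (∀ m → V m → U m ⊎ x ∣ᵐ m) → (∀ m → U m ⊎ x ∣ᵐ m → V m) →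
    LinearResolution e (λ i → r i + aug (kosz k) i) ⟦ V ⟧
  add-generator {U = U} {V = V} U? A x F H deg-x A⇒colon colon⇒A V⇒ V⇐ =
    transport
      (λ f f∈ → ⟦⟧-mono V⇐ f (add-generator⇐ U? x f f∈))
      (λ f f∈ → add-generator⇒ U? x f (⟦⟧-mono V⇒ f f∈))
      (cone-resolution F H (monomial x) (π-monomial-≈ x deg-x)
        (λ f f∈ → colon⇐ x f (⟦⟧-mono A⇒colon f f∈))
        (λ f f∈ → ⟦⟧-mono colon⇒A f (colon⇒ x f f∈)))

  -- The variable x is regular modulo the others, so the colon ideal of (A - x) by x is (A - x)
  -- again and the same resolution enters the cone twice. On ranks this is Pascal's rule.
  koszul : ∀ k A → ∣ A ∣ ≡ k → LinearResolution 1 (kosz k) ⟦ Vars A ⟧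
  koszul zero A ∣A∣≡0 = transport (λ f f≈0 m _ → f≈0 m) (λ f f∈ m → f∈ m (none m)) (zero-resolution 1)
    where
    none : ∀ m → ¬ Vars A m
    none m ((i , i∈A) , _) with ≡.trans (∣p-x∣ i∈A) ∣A∣≡0
    ... | ()
  koszul (suc k) A ∣A∣≡1+k with nonempty? A
  ... | no  empty with ≡.trans (≡.sym ∣A∣≡1+k) (≡.trans (≡.cong ∣_∣ (Empty-unique empty)) (∣⊥∣≡0 n))
  ...   | ()
  koszul (suc k) A ∣A∣≡1+k | yes (x , x∈A) =
    add-generator {k = k} (Vars? (A - x)) (A - x) (𝐱 ⁅ x ⁆) K′ K′ (≡.trans (degree-𝐱 ⁅ x ⁆) (∣⁅x⁆∣≡1 x))
      (λ m m∈ → let (i , i∈ , p) = vars⁻¹ m∈ in vars i∈ (supp-*⇐ʳ {𝐱 ⁅ x ⁆} p))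
      regular split-x join-x
    where
    K′ = koszul k (A - x) (ℕ.suc-injective (≡.trans (∣p-x∣ x∈A) ∣A∣≡1+k))
    regular : ∀ m → Vars (A - x) (𝐱 ⁅ x ⁆ *ᵐ m) → Vars (A - x) m
    regular m m∈ with vars⁻¹ m∈
    ... | i , i∈ , p with supp-*⇒ {𝐱 ⁅ x ⁆} {m} p
    ...   | inj₁ q = ⊥-elim (x∈p─q⇒x∉q A ⁅ x ⁆ i∈ (supp-𝐱⇒ q))
    ...   | inj₂ q = vars i∈ q
    split-x : ∀ m → Vars A m → Vars (A - x) m ⊎ 𝐱 ⁅ x ⁆ ∣ᵐ m
    split-x m m∈ with vars⁻¹ m∈
    ... | i , i∈ , p with i Fin.≟ x
    ...   | yes ≡.refl = inj₂ (𝐱∣⇐ λ j∈ → ≡.subst (Supp m) (≡.sym (x∈⁅y⁆⇒x≡y i j∈)) p)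
    ...   | no  i≢x    = inj₁ (vars (x∈p∧x≢y⇒x∈p-y i∈ i≢x) p)
    join-x : ∀ m → Vars (A - x) m ⊎ 𝐱 ⁅ x ⁆ ∣ᵐ m → Vars A m
    join-x m (inj₁ m∈) = let (i , i∈ , p) = vars⁻¹ m∈ in vars (p─q⊆p A ⁅ x ⁆ i∈) p
    join-x m (inj₂ d)  = vars x∈A (𝐱∣⇒ d (x∈⁅x⁆ x))

  -- Iterated cones along linear quotients

  Div : List Monomial → Pred Monomial _
  Div ms m = Any (_∣ᵐ m) ms

  Div? : ∀ ms → Decidable (Div ms)
  Div? ms m = any? (_∣ᵐ? m) ms

  ColonVars : List Monomial → Monomial → Subset n → Set
  ColonVars ms x A = ∀ m → (Vars A m → Div ms (x *ᵐ m)) × (Div ms (x *ᵐ m) → Vars A m)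

  Resolved : ℕ → List Monomial → (ℕ → ℕ) → Set _
  Resolved e ms r = LinearResolution e r ⟦ Div ms ⟧

  -- Generator j adds binomial (∣ A j ∣, i) to the rank in degree i, which is 0 exactly when ∣ A j ∣
  -- < i. Since natural numbers do not cancel, recording where the ranks vanish is enough.
  extend : ∀ {e} ms xs r → Resolved e ms r → (∀ j → degree (List.lookup xs j) ≡ e) →
    (A : Fin (length xs) → Subset n) →
    (∀ j → ColonVars (ms ++ take (toℕ j) xs) (List.lookup xs j) (A j)) →
    ∃[ r′ ] Resolved e (ms ++ xs) r′ ×
      (∀ i → r′ i ≡ 0 → r i ≡ 0 × (∀ j → ∣ A j ∣ < i)) ×
      (∀ i → r i ≡ 0 → (∀ j → ∣ A j ∣ < i) → r′ i ≡ 0)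
  extend {e} ms [] r F deg A colon =
    r , ≡.subst (λ l → Resolved e l r) (≡.sym (++-identityʳ ms)) F , (λ i eq → eq , λ ()) , λ i eq _ → eq
  extend {e} ms (x ∷ xs) r F deg A colon
    with extend (ms ∷ʳ x) xs _ F′ (deg ∘ suc) (A ∘ suc)
           (λ j → ≡.subst (λ l → ColonVars l (List.lookup xs j) (A (suc j)))
             (≡.sym (∷ʳ-++ ms x (take (toℕ j) xs))) (colon (suc j)))
    where
    F′ : Resolved e (ms ∷ʳ x) (λ i → r i + aug (kosz ∣ A zero ∣) i)
    F′ = add-generator {k = ∣ A zero ∣} (Div? ms) (A zero) x F (koszul _ (A zero) ≡.refl) (deg zero)
      (λ m m∈ → ≡.subst (λ l → Div l (x *ᵐ m)) (++-identityʳ ms) (proj₁ (colon zero m) m∈))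
      (λ m m∈ → proj₂ (colon zero m) (≡.subst (λ l → Div l (x *ᵐ m)) (≡.sym (++-identityʳ ms)) m∈))
      (λ m m∈ → Sum.map₂ (λ { (here d) → d }) (Any.++⁻ ms m∈))
      (λ { m (inj₁ m∈) → Any.++⁺ˡ m∈ ; m (inj₂ d) → Any.++⁺ʳ ms (here d) })
  ... | r′ , G , ⇒ , ⇐ = r′ , ≡.subst (λ l → Resolved e l r′) (∷ʳ-++ ms x xs) G
      , (λ i eq → let (eq′ , <i) = ⇒ i eq in
           ℕ.m+n≡0⇒m≡0 (r i) eq′
         , λ { zero → kosz-zero⁻¹ _ i (ℕ.m+n≡0⇒n≡0 (r i) eq′) ; (suc j) → <i j })
      , λ i eq <i → ⇐ i (≡.cong₂ _+_ eq (kosz-zero _ i (<i zero))) (<i ∘ suc)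

  linear-quotients-resolution : ∀ {e} ms → (∀ j → degree (List.lookup ms j) ≡ e) →
    (A : Fin (length ms) → Subset n) →
    (∀ j → ColonVars (take (toℕ j) ms) (List.lookup ms j) (A j)) →
    ∃[ r ] Resolved e ms r × (∀ i → r i ≡ 0 → ∀ j → ∣ A j ∣ < i) × (∀ i → (∀ j → ∣ A j ∣ < i) → r i ≡ 0)
  linear-quotients-resolution {e} ms deg A colon
    with extend [] ms _
           (transport (λ f f≈0 m _ → f≈0 m) (λ f f∈ m → f∈ m λ ()) (zero-resolution e)) deg A colon
  ... | r , F , ⇒ , ⇐ = r , F , (λ i eq → proj₂ (⇒ i eq)) , λ i <i → ⇐ i ≡.refl <i

-- Betti numbers and projective dimension

module BettiNumbers {c ℓ₁ ℓ₂} (𝕂 : HeytingField c ℓ₁ ℓ₂) (n : ℕ) where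
  open PolynomialRing 𝕂 n
  open MonomialIdeals 𝕂 n
  open GradedMaps R grading
  open LinearMaps R
  open _⊸_
  module Kᵐ = LinearMaps K
  module Kᴸ = LinearAlgebra coefficientRing
  module Rᴸ = LinearAlgebra polynomialRing
  open SetoidReasoning K.setoid

  constant-sum : ∀ {m} (v : Vector Poly m) → constant (Rᴸ.sum v) K.≈ Kᴸ.sum (λ s → constant (v s))
  constant-sum {zero}  v = K.refl
  constant-sum {suc m} v = K.trans
    (coeff-++ (v zero) (Rᴸ.sum (λ s → v (suc s))) 1ᵐ)
    (K.+-congˡ (constant-sum (λ s → v (suc s))))

  constant-dot : ∀ {m} (u v : Vector Poly m) →
    constant (Rᴸ.dot u v) K.≈ Kᴸ.dot (λ s → constant (u s)) (λ s → constant (v s))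
  constant-dot {m} u v = K.trans (constant-sum (λ s → u s R.* v s))
    (Kᵐ.sum-cong {m} (λ s → constant-* (u s) (v s)))

  constant-fn : ∀ {m r} (f : m ⊸ r) v → (∀ s → constant (v s) K.≈ K.0#) → ∀ i → constant (fn f v i) K.≈ K.0#
  constant-fn {m} f v v≈0 i = begin
    constant (fn f v i)                                        ≈⟨ toMatrix-· f v i 1ᵐ ⟩
    constant (Rᴸ.dot (toMatrix f i) v)                         ≈⟨ constant-dot (toMatrix f i) v ⟩
    Kᴸ.dot (λ s → constant (toMatrix f i s)) (λ s → constant (v s))
      ≈⟨ Kᵐ.sum-zero {m} _ (λ s → K.trans (K.*-congˡ (v≈0 s)) (K.zeroʳ _)) ⟩
    K.0#                                                       ∎

  constant-homogeneous : ∀ f → π 1 f R.≈ f → constant f K.≈ K.0#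
  constant-homogeneous f hom = K.trans (K.sym (hom 1ᵐ))
    (coeff-filter-no (degree? 1) f (λ eq → ℕ.0≢1+n (≡.trans (≡.sym degree-1) eq)))

  module _ {I : Ideal} (F : FreeResolution I) where
    open FreeResolution F

    acyclic : Acyclic rank
    acyclic .Acyclic.d zero    = fromMatrix (λ _ → ε)
    acyclic .Acyclic.d (suc i) = fromMatrix (∂ i)
    acyclic .Acyclic.complex zero v _ =
      Equivalence.from (exact₀ (∂ 0 Rᴸ.· v)) (v , λ _ _ → K.refl)
    acyclic .Acyclic.complex (suc i) v =
      Equivalence.from (exact i (∂ (suc i) Rᴸ.· v)) (v , λ _ _ → K.refl)
    acyclic .Acyclic.exact zero v εv≈0 = Equivalence.to (exact₀ v) (εv≈0 zero)
    acyclic .Acyclic.exact (suc i) v ∂v≋0 = Equivalence.to (exact i v) ∂v≋0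

    image⇒ : ∀ f → Acyclic.Image acyclic f → I f
    image⇒ f (v , eq) = proj₂ onto (v , eq zero)

    image⇐ : ∀ f → I f → Acyclic.Image acyclic f
    image⇐ f f∈ = let (v , eq) = proj₁ onto f∈ in v , λ _ → eq

    open Tor F

    -- Over K, the contraction given by comparison with a resolution vanishing in degree j
    -- shows that every cycle in degree j is a boundary.
    no-basis : ∀ {r} (Y : Acyclic r) →
      (∀ f → I f → Acyclic.Image Y f) → (∀ f → Acyclic.Image Y f → I f) →
      ∀ j → r (suc j) ≡ 0 → ∀ {b} (z : Vector (Vector K.Carrier (rank (suc j))) b) → IsBasis (suc j) z → b ≡ 0
    no-basis Y I⇒Y Y⇒I j r≡0 {zero}  z basis-z = ≡.refl
    -- The first cycle of a nonempty family is a boundary; independence at the coefficients (1, 0,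
    -- ..., 0) would then give 1 = 0.
    no-basis Y I⇒Y Y⇒I j r≡0 {suc b} z basis-z = ⊥-elim (1≉0 (independent (Kᵐ.basis zero)
        (w , λ i → K.trans (Kᵐ.sum-basisˡ (λ k → z k i) zero) (boundary i)) zero))
      where
      open IsBasis basis-z
      module C = Comparison acyclic Y (λ f im → I⇒Y f (image⇒ f im)) (λ f im → image⇐ f (Y⇒I f im))
      -- The contraction lives over R, so the cycle is lifted to a vector of constant polynomials.
      v : Vector Poly (rank (suc j))
      v i = (z zero i , 1ᵐ) ∷ []
      constant-v : ∀ i → constant (v i) K.≈ z zero i
      constant-v i with 1ᵐ ≟ᵐ 1ᵐ
      ... | yes _  = K.+-identityʳ _
      ... | no 1≢1 = ⊥-elim (1≢1 ≡.refl)
      sv : Vector Poly (rank (suc (suc j)))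
      sv = fn (C.s (suc (suc j))) v
      w : Vector K.Carrier (rank (suc (suc j)))
      w s = constant (sv s)
      ∂v : Vector Poly (rank j)
      ∂v = ∂ j Rᴸ.· v
      constant-∂v : ∀ i → constant (∂v i) K.≈ K.0#
      constant-∂v i = begin
        constant (∂v i)  ≈⟨ constant-dot (∂ j i) v ⟩
        Kᴸ.dot (∂⊗K j i) (λ s → constant (v s))
          ≈⟨ Kᵐ.sum-cong {rank (suc j)} (λ s → K.*-congˡ (constant-v s)) ⟩
        Kᴸ.dot (∂⊗K j i) (z zero)  ≈⟨ cycles zero i ⟩
        K.0#  ∎
      -- Of the two summands of the contraction, s applied to ∂v has no constant term, because ∂v
      -- has none for a cycle; the other one is a boundary.
      boundary : ∀ i → z zero i K.≈ (∂⊗K (suc j) Kᴸ.· w) i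
      boundary i = begin
        z zero i                        ≈⟨ constant-v i ⟨
        constant (v i)                  ≈⟨ C.contraction (suc j) r≡0 v i 1ᵐ ⟩
        constant (fn (C.s (suc j)) ∂v i R.+ (∂ (suc j) Rᴸ.· sv) i)
          ≈⟨ coeff-++ (fn (C.s (suc j)) ∂v i) _ 1ᵐ ⟩
        constant (fn (C.s (suc j)) ∂v i) K.+ constant ((∂ (suc j) Rᴸ.· sv) i)
          ≈⟨ K.+-cong (constant-fn (C.s (suc j)) ∂v constant-∂v i) (constant-dot (∂ (suc j) i) sv) ⟩
        K.0# K.+ (∂⊗K (suc j) Kᴸ.· w) i  ≈⟨ K.+-identityˡ _ ⟩
        (∂⊗K (suc j) Kᴸ.· w) i           ∎

  module _ {p e r} {I : Ideal} {J : Pred Poly p} (G : LinearResolution e r J)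
    (I⇒J : ∀ f → I f → J f) (J⇒I : ∀ f → J f → I f) where
    open LinearResolution G hiding (acyclic; exact)

    private
      module G = LinearResolution G

    free : FreeResolution I
    free = record
      { rank   = r
      ; ε      = toMatrix (d 0) zero
      ; ∂      = λ i → toMatrix (d (suc i))
      ; onto   = (λ {f} f∈ → let (v , eq) = image f (I⇒J f f∈) in
                   v , λ m → K.trans (eq zero m) (toMatrix-· (d 0) v zero m))
               , (λ {f} (v , eq) → J⇒I f (image⁻¹ f
                   (v , λ { zero m → K.trans (eq m) (K.sym (toMatrix-· (d 0) v zero m)) })))
      ; exact₀ = λ v → mk⇔
          (λ εv≈0 → replace 0 {v} (G.exact 0 v λ { zero m → K.trans (toMatrix-· (d 0) v zero m) (εv≈0 m) }))
          (λ { (w , eq) m → K.trans (K.sym (toMatrix-· (d 0) v zero m)) (composite 0 v w eq zero m) })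
      ; exact  = λ i v → mk⇔
          (λ ∂v≋0 → replace (suc i) {v} (G.exact (suc i) v
            λ j m → K.trans (toMatrix-· (d (suc i)) v j m) (∂v≋0 j m)))
          (λ { (w , eq) j m → K.trans (K.sym (toMatrix-· (d (suc i)) v j m)) (composite (suc i) v w eq j m) })
      }
      where
      replace : ∀ i {v} → (∃[ w ] v Rᴸ.≋ fn (d (suc i)) w) → ∃[ w ] v Rᴸ.≋ toMatrix (d (suc i)) Rᴸ.· w
      replace i (w , eq) = w , λ j m → K.trans (eq j m) (toMatrix-· (d (suc i)) w j m)
      composite : ∀ i v w → v Rᴸ.≋ toMatrix (d (suc i)) Rᴸ.· w → fn (d i) v Rᴸ.≋ Rᴸ.0ᵛ
      composite i v w eq j m = K.trans
        (cong (d i) (λ k l → K.trans (eq k l) (K.sym (toMatrix-· (d (suc i)) w k l))) j m)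
        (complex i w j m)

    open Tor free

    -- Minimality: the entries are homogeneous of degree 1.
    ∂⊗K-zero : ∀ i s t → ∂⊗K i s t K.≈ K.0#
    ∂⊗K-zero i s t = constant-homogeneous (fn (d (suc i)) (basis t) s)
      (graded-basis (d (suc i)) (graded (suc i)) t s)

    ∂⊗K-·-zero : ∀ i z → ∂⊗K i Kᴸ.· z Kᴸ.≋ Kᴸ.0ᵛ
    ∂⊗K-·-zero i z s = Kᵐ.sum-zero {r (suc i)} _ λ t → K.trans (K.*-congʳ (∂⊗K-zero i s t)) (K.zeroˡ _)

    -- All maps of the complex tensored with K are zero, so every vector is a cycle and only 0 is a
    -- boundary: Tor in degree i is the whole of K ^ r i.
    standard-basis : ∀ i → IsBasis i {r i} Kᵐ.basis
    standard-basis i = record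
      { cycles      = cycles i
      ; independent = λ a (w , eq) s → K.trans (K.sym (Kᵐ.sum-basis a s)) (K.trans (eq s) (∂⊗K-·-zero i w s))
      ; spanning    = λ y _ → y , Kᴸ.0ᵛ , λ s → begin
          y s K.+ K.- combination y Kᵐ.basis s  ≈⟨ K.+-congˡ (K.-‿cong (Kᵐ.sum-basis y s)) ⟩
          y s K.+ K.- y s                       ≈⟨ K.-‿inverseʳ _ ⟩
          K.0#                                  ≈⟨ ∂⊗K-·-zero i Kᴸ.0ᵛ s ⟨
          (∂⊗K i Kᴸ.· Kᴸ.0ᵛ) s                  ∎
      }
      where
      cycles : ∀ i k → Cycle i (Kᵐ.basis {r i} k)
      cycles zero    k = tt
      cycles (suc i) k = ∂⊗K-·-zero i (Kᵐ.basis k)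

    betti-nonzero : ∀ i → r i ≢ 0 → BettiNonzero I i
    betti-nonzero i r≢0 = r i , (free , Kᵐ.basis , standard-basis i) , r≢0

    betti-vanishing : ∀ j → r (suc j) ≡ 0 → ¬ BettiNonzero I (suc j)
    betti-vanishing j r≡0 (b , (F , z , basis-z) , b≢0) = b≢0
      (no-basis F G.acyclic (λ f f∈ → image f (I⇒J f f∈)) (λ f im → J⇒I f (image⁻¹ f im)) j r≡0 z basis-z)

    pdim : ∀ i → r i ≢ 0 → (∀ j → i < j → r j ≡ 0) → IsPdim I [ ℤ.+ i ]
    pdim i r≢0 vanish = pdim-max i (betti-nonzero i r≢0) bound
      where
      bound : ∀ j → BettiNonzero I j → j ≤ i
      bound zero    _ = z≤n
      bound (suc j) β≢0 with suc j ℕ.≤? i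
      ... | yes 1+j≤i = 1+j≤i
      ... | no  1+j≰i = ⊥-elim (betti-vanishing j (vanish (suc j) (ℕ.≰⇒> 1+j≰i)) β≢0)

-- Exposed circuits

⊆∧∣∣≡⇒≡ : ∀ {n} {p q : Subset n} → p ⊆ q → ∣ p ∣ ≡ ∣ q ∣ → p ≡ q
⊆∧∣∣≡⇒≡ {p = p} {q} p⊆q eq = ⊆-antisym p⊆q q⊆p
  where
  q⊆p : q ⊆ p
  q⊆p {x} x∈q with x ∈? p
  ... | yes x∈p = x∈p
  ... | no  x∉p = ⊥-elim (ℕ.<-irrefl eq (p⊂q⇒∣p∣<∣q∣ (p⊆q , x , x∈q , x∉p)))

⊈⇒∃ : ∀ {n} (p q : Subset n) → ¬ (p ⊆ q) → ∃[ x ] x ∈ p × x ∉ q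
⊈⇒∃ p q p⊈q with Fin.any? (λ x → (x ∈? p) ×-dec ¬? (x ∈? q))
... | yes found = found
... | no  none  = ⊥-elim (p⊈q λ {x} x∈p → decidable-stable (x ∈? q) (λ x∉q → none (x , x∈p , x∉q)))

_≟ˢ_ : ∀ {n} (p q : Subset n) → Dec (p ≡ q)
_≟ˢ_ = Vec.≡-dec Bool._≟_

-- For xs and e ∉ xs of equal size this says that the colon ideal of ⟨𝐱_f : f ∈ xs⟩
-- by 𝐱_e is generated by the variables in A.
Separates : ∀ {n} → List (Subset n) → Subset n → Subset n → Set
Separates xs e A =
  (∀ {f} → f ∈ᴸ xs → ∃[ i ] i ∈ A × i ∈ f × i ∉ e) ×
  (∀ {i} → i ∈ A → ∃[ f ] f ∈ᴸ xs × f ⊆ e ∪ ⁅ i ⁆)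

separates⇒∉ : ∀ {n} {xs : List (Subset n)} {e A} → Separates xs e A → ¬ (e ∈ᴸ xs)
separates⇒∉ (meets , _) e∈xs = let (_ , _ , i∈e , i∉e) = meets e∈xs in i∉e i∈e

module _ {d n : ℕ} where

  Missing : List (Subset n) → Clutter d n → Set
  Missing xs C = (∀ {f} → f ∈ᴸ xs → ∣ f ∣ ≡ d × ¬ Circuit C f) ×
                 (∀ {f} → ∣ f ∣ ≡ d → ¬ Circuit C f → f ∈ᴸ xs)

  -- The inequality is d < ∣ ∁ A ∣ written without subtraction; `∁ A` is the maximal clique around
  -- e.
  LinearStep : List (Subset n) → Subset n → Set
  LinearStep xs e = ∃[ A ] Separates xs e A × ∣ A ∣ + d < n

  module _ (C : Clutter d n) where

    Gap : Subset n → Pred (Subset n) _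
    Gap S f = ∣ f ∣ ≡ d × f ⊆ S × ¬ Circuit C f

    gap? : ∀ S → Dec (∃ (Gap S))
    gap? S = anySubset? (λ f → (∣ f ∣ ℕ.≟ d) ×-dec (f ⊆? S) ×-dec ¬? (circuit? C f))

    no-gap : ∀ {S} → ¬ ∃ (Gap S) → ∀ f → ∣ f ∣ ≡ d → f ⊆ S → Circuit C f
    no-gap none f ∣f∣≡d f⊆S = decidable-stable (circuit? C f) λ f∉C → none (f , ∣f∣≡d , f⊆S , f∉C)

    clique? : Decidable (Clique C)
    clique? S = nonempty? S ×-dec ((∣ S ∣ ℕ.<? d) ⊎-dec ((d ℕ.≤? ∣ S ∣) ×-dec all?))
      where
      all? : Dec (∀ e → ∣ e ∣ ≡ d → e ⊆ S → Circuit C e)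
      all? = map′ no-gap (λ all (f , ∣f∣≡d , f⊆S , f∉C) → f∉C (all f ∣f∣≡d f⊆S)) (¬? (gap? S))

    extend-to-maximal : ∀ S → Clique C S → ∃[ T ] MaximalClique C T × S ⊆ T
    extend-to-maximal S = go S (⊃-wellFounded S)
      where
      go : ∀ S → Acc _⊃_ S → Clique C S → ∃[ T ] MaximalClique C T × S ⊆ T
      go S (acc rec) S-clique with anySubset? (λ T → clique? T ×-dec (S ⊂? T))
      ... | yes (T , T-clique , S⊂T) =
        let (U , U-max , T⊆U) = go T (rec S⊂T) T-clique in U , U-max , T⊆U ∘ proj₁ S⊂T
      ... | no none = S , (S-clique , maximal) , id
        where
        maximal : ∀ T → Clique C T → S ⊆ T → T ≡ S
        maximal T T-clique S⊆T = ⊆-antisym T⊆S S⊆T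
          where
          T⊆S : T ⊆ S
          T⊆S {x} x∈T = decidable-stable (x ∈? S) (λ x∉S → none (T , T-clique , S⊆T , x , x∈T , x∉S))

    -- A clique containing a d-set has at least d elements, which excludes the first alternative of
    -- `Clique`.
    clique-circuit : ∀ {T e f} → Clique C T → ∣ e ∣ ≡ d → e ⊆ T → ∣ f ∣ ≡ d → f ⊆ T → Circuit C f
    clique-circuit (_ , inj₁ ∣T∣<d) ∣e∣≡d e⊆T ∣f∣≡d f⊆T =
      ⊥-elim (ℕ.<⇒≱ ∣T∣<d (≡.subst (_≤ _) ∣e∣≡d (p⊆q⇒∣p∣≤∣q∣ e⊆T)))
    clique-circuit (_ , inj₂ (_ , all)) ∣e∣≡d e⊆T ∣f∣≡d f⊆T = all _ ∣f∣≡d f⊆T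

    -- The unique maximal clique containing e is the complement of the set of variables
    -- generating the colon ideal.
    module _ (1≤d : 1 ≤ d) {xs} (missing : Missing xs C) {e} (e∈C : Circuit C e) where

      private
        ∣e∣≡d : ∣ e ∣ ≡ d
        ∣e∣≡d = uniform C e∈C

        e-nonempty : Nonempty e
        e-nonempty with nonempty? e
        ... | yes ne = ne
        ... | no empty = ⊥-elim (ℕ.<⇒≱ 1≤d (ℕ.≤-reflexive
          (≡.trans (≡.sym ∣e∣≡d) (≡.trans (≡.cong ∣_∣ (Empty-unique empty)) (∣⊥∣≡0 n)))))

      exposed⇒linear : ProperlyExposed C e → LinearStep xs e
      exposed⇒linear (S , (_ , (S-clique , _) , e⊆S , unique) , d<∣S∣) = ∁ S , (meets , generates) , size
        where
        size : ∣ ∁ S ∣ + d < n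
        size = ≡.subst (λ k → k + d < n) (≡.sym (∣∁p∣≡n∸∣p∣ S))
          (ℕ.<-≤-trans (ℕ.+-monoʳ-< (n ∸ ∣ S ∣) d<∣S∣) (ℕ.≤-reflexive (ℕ.m∸n+n≡m (∣p∣≤n S))))
        -- A missing f cannot lie in the clique S, so it has an element outside S, and in particular
        -- outside e.
        meets : ∀ {f} → f ∈ᴸ xs → ∃[ i ] i ∈ ∁ S × i ∈ f × i ∉ e
        meets {f} f∈xs =
          let (∣f∣≡d , f∉C) = proj₁ missing f∈xs
              (i , i∈f , i∉S) = ⊈⇒∃ f S (λ f⊆S → f∉C (clique-circuit S-clique ∣e∣≡d e⊆S ∣f∣≡d f⊆S))
          in i , x∉p⇒x∈∁p i∉S , i∈f , i∉S ∘ e⊆S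
        generates : ∀ {i} → i ∈ ∁ S → ∃[ f ] f ∈ᴸ xs × f ⊆ e ∪ ⁅ i ⁆
        generates {i} i∈∁S
          with gap? (e ∪ ⁅ i ⁆)
        ... | yes (f , ∣f∣≡d , f⊆ , f∉C) = f , proj₂ missing ∣f∣≡d f∉C , f⊆
        -- Without a missing d-set inside it, e ∪ ⁅ i ⁆ is a clique. A maximal clique above it
        -- contains e, so it is S, and i would lie in S.
        ... | no none = ⊥-elim (x∈∁p⇒x∉p i∈∁S (≡.subst (i ∈_) T≡S (e∪i⊆T (x∈p∪q⁺ (inj₂ (x∈⁅x⁆ i))))))
          where
          e∪i-clique : Clique C (e ∪ ⁅ i ⁆)
          e∪i-clique = (proj₁ e-nonempty , p⊆p∪q ⁅ i ⁆ (proj₂ e-nonempty))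
            , inj₂ (≡.subst (_≤ _) ∣e∣≡d (p⊆q⇒∣p∣≤∣q∣ (p⊆p∪q {p = e} ⁅ i ⁆)) , no-gap none)
          maximal = extend-to-maximal (e ∪ ⁅ i ⁆) e∪i-clique
          e∪i⊆T = proj₂ (proj₂ maximal)
          T≡S = unique _ (proj₁ (proj₂ maximal)) (e∪i⊆T ∘ p⊆p∪q ⁅ i ⁆)

      -- `generates` keeps every clique through e away from A, and `meets` makes `∁ A` itself a
      -- clique. So `∁ A` is the largest clique containing e and hence the unique maximal one.
      linear⇒exposed : LinearStep xs e → ProperlyExposed C e
      linear⇒exposed (A , (meets , generates) , size) =
          S , (e∈C , (S-clique , λ T T-clique S⊆T → ⊆-antisym (below T T-clique (S⊆T ∘ e⊆S)) S⊆T) , e⊆S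
        , λ T (T-clique , T-max) e⊆T → ≡.sym (T-max S S-clique (below T T-clique e⊆T)))
        , d<∣S∣
        where
        S = ∁ A
        d<∣S∣ : d < ∣ S ∣
        d<∣S∣ = ≡.subst (d <_) (≡.sym (∣∁p∣≡n∸∣p∣ A))
          (ℕ.m+n≤o⇒m≤o∸n (suc d) (ℕ.≤-trans (s≤s (ℕ.≤-reflexive (ℕ.+-comm d ∣ A ∣))) size))
        -- For i in both A and e, the missing f would lie in e and have the same size, so it would
        -- equal the circuit e.
        e⊆S : e ⊆ S
        e⊆S {i} i∈e = x∉p⇒x∈∁p λ i∈A →
          let (f , f∈xs , f⊆) = generates i∈A
              (∣f∣≡d , f∉C) = proj₁ missing f∈xs
              f⊆e : f ⊆ e
              f⊆e = Sum.[ id , (λ j∈ → ≡.subst (_∈ e) (≡.sym (x∈⁅y⁆⇒x≡y i j∈)) i∈e) ]′ ∘ x∈p∪q⁻ e ⁅ i ⁆ ∘ f⊆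
          in f∉C (≡.subst (Circuit C) (≡.sym (⊆∧∣∣≡⇒≡ f⊆e (≡.trans ∣f∣≡d (≡.sym ∣e∣≡d)))) e∈C)
        S-clique : Clique C S
        S-clique = (proj₁ e-nonempty , e⊆S (proj₂ e-nonempty)) , inj₂ (ℕ.<⇒≤ d<∣S∣ , λ f ∣f∣≡d f⊆S →
          decidable-stable (circuit? C f) λ f∉C →
            let (i , i∈A , i∈f , _) = meets (proj₂ missing ∣f∣≡d f∉C) in x∈∁p⇒x∉p (f⊆S i∈f) i∈A)
        below : ∀ T → Clique C T → e ⊆ T → T ⊆ S
        below T T-clique e⊆T {i} i∈T = x∉p⇒x∈∁p λ i∈A →
          let (f , f∈xs , f⊆) = generates i∈A
              (∣f∣≡d , f∉C) = proj₁ missing f∈xs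
          in f∉C (clique-circuit T-clique ∣e∣≡d e⊆T ∣f∣≡d
               (Sum.[ e⊆T , (λ j∈ → ≡.subst (_∈ T) (≡.sym (x∈⁅y⁆⇒x≡y i j∈)) i∈T) ]′ ∘ x∈p∪q⁻ e ⁅ i ⁆ ∘ f⊆))

  -- Sequences of erasures

  erase : Clutter d n → Subset n → Clutter d n
  erase C e .Circuit f = Circuit C f × f ≢ e
  erase C e .circuit? f = circuit? C f ×-dec ¬? (f ≟ˢ e)
  erase C e .uniform = uniform C ∘ proj₁

  missing-erase : ∀ {C D xs e} → Missing xs C → Circuit C e → Circuit D ≐ (λ f → Circuit C f × f ≢ e) →
                  Missing (xs ∷ʳ e) D
  missing-erase {C} {D} {xs} {e} (sound , complete) e∈C (D⇒ , D⇐) = sound′ , complete′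
    where
    sound′ : ∀ {f} → f ∈ᴸ xs ∷ʳ e → ∣ f ∣ ≡ d × ¬ Circuit D f
    sound′ {f} f∈ with ∈-++⁻ xs f∈
    ... | inj₁ f∈xs = proj₁ (sound f∈xs) , proj₂ (sound f∈xs) ∘ proj₁ ∘ D⇒
    ... | inj₂ (here f≡e) = ≡.trans (≡.cong ∣_∣ f≡e) (uniform C e∈C) , λ f∈D → proj₂ (D⇒ f∈D) f≡e
    complete′ : ∀ {f} → ∣ f ∣ ≡ d → ¬ Circuit D f → f ∈ᴸ xs ∷ʳ e
    complete′ {f} ∣f∣≡d f∉D with f ≟ˢ e
    ... | yes f≡e = ∈-++⁺ʳ xs (here f≡e)
    ... | no  f≢e = ∈-++⁺ˡ (complete ∣f∣≡d (λ f∈C → f∉D (D⇐ (f∈C , f≢e))))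

  -- `xs` accumulates the circuits erased so far. The next one is a circuit at the moment of its
  -- erasure, so it is new to the list.
  erasures⇒linear : 1 ≤ d → ∀ {C D} → Star Erasure C D → ∀ xs → Missing xs C → Unique xs →
    ∃[ ys ] Missing (xs ++ ys) D × Unique (xs ++ ys) ×
      (∀ (j : Fin (length ys)) → LinearStep (xs ++ take (toℕ j) ys) (List.lookup ys j))
  erasures⇒linear 1≤d {C} Star.ε xs missing unique = []
    , ≡.subst (λ l → Missing l C) (≡.sym (++-identityʳ xs)) missing
    , ≡.subst Unique (≡.sym (++-identityʳ xs)) unique
    , λ ()
  erasures⇒linear 1≤d {C} {D} (_◅_ {j = C′} (e , exposed , C′≐) steps) xs missing unique =
      e ∷ ys
    , ≡.subst (λ l → Missing l D) (∷ʳ-++ xs e ys) missing′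
    , ≡.subst Unique (∷ʳ-++ xs e ys) unique′
    , λ { zero    → ≡.subst (λ l → LinearStep l e) (≡.sym (++-identityʳ xs)) step
        ; (suc j) → ≡.subst (λ l → LinearStep l (List.lookup ys j)) (∷ʳ-++ xs e (take (toℕ j) ys)) (linear j) }
    where
    e∈C = proj₁ (proj₁ (proj₂ exposed))
    step = exposed⇒linear C 1≤d missing e∈C exposed
    rest = erasures⇒linear 1≤d steps (xs ∷ʳ e) (missing-erase {C} {C′} missing e∈C C′≐)
      (Unique.++⁺ unique ([] ∷ []) λ { (v∈xs , here ≡.refl) → proj₂ (proj₁ missing v∈xs) e∈C })
    ys = proj₁ rest
    missing′ = proj₁ (proj₂ rest)
    unique′ = proj₁ (proj₂ (proj₂ rest))
    linear = proj₂ (proj₂ (proj₂ rest))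

  linear⇒erasures : 1 ≤ d → ∀ C xs ys → Missing xs C → (∀ {f} → f ∈ᴸ ys → ∣ f ∣ ≡ d) →
    (∀ (j : Fin (length ys)) → LinearStep (xs ++ take (toℕ j) ys) (List.lookup ys j)) →
    ∃[ D ] Star Erasure C D × Missing (xs ++ ys) D
  linear⇒erasures 1≤d C xs [] missing sizes linear =
    C , Star.ε , ≡.subst (λ l → Missing l C) (≡.sym (++-identityʳ xs)) missing
  linear⇒erasures 1≤d C xs (e ∷ ys) missing sizes linear =
    let (D , steps , missing′) = linear⇒erasures 1≤d (erase C e) (xs ∷ʳ e) ys
          (missing-erase {C} {erase C e} missing e∈C (id , id)) (sizes ∘ there)
          (λ j → ≡.subst (λ l → LinearStep l (List.lookup ys j)) (≡.sym (∷ʳ-++ xs e (take (toℕ j) ys)))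
                   (linear (suc j)))
    in D , (e , linear⇒exposed C 1≤d missing e∈C step , id , id) ◅ steps
         , ≡.subst (λ l → Missing l D) (∷ʳ-++ xs e ys) missing′
    where
    step : LinearStep xs e
    step = ≡.subst (λ l → LinearStep l e) (++-identityʳ xs) (linear zero)
    -- Separation forbids e among the earlier entries: no member f = e has an element outside e. So
    -- e has not been erased yet.
    e∈C : Circuit C e
    e∈C = decidable-stable (circuit? C e) λ e∉C →
      separates⇒∉ (proj₁ (proj₂ step)) (proj₂ missing (sizes (here ≡.refl)) e∉C)

-- Erasures and linear quotients

open import Data.Integer.Base using (+_)

argmax : ∀ {k} (h : Fin (suc k) → ℕ) → ∃[ i ] ∀ j → h j ≤ h i
argmax {zero}  h = zero , λ { zero → ℕ.≤-refl }
argmax {suc k} h with argmax (h ∘ suc)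
... | i , max with ℕ.≤-total (h zero) (h (suc i))
...   | inj₁ 0≤i = suc i , λ { zero → 0≤i ; (suc j) → max j }
...   | inj₂ i≤0 = zero , λ { zero → ℕ.≤-refl ; (suc j) → ℕ.≤-trans (max j) i≤0 }

module _ {a b} {A : Set a} {B : Set b} (f : A → B) where

  -- The indices of xs and of its image under f have different types, so the recursion moves between
  -- them, with `P` absorbing the head of the list.
  prefixes-map⁺ : ∀ {p} (P : List B → B → Set p) xs →
    (∀ (j : Fin (length xs)) → P (List.map f (take (toℕ j) xs)) (f (List.lookup xs j))) →
    ∀ (j : Fin (length (List.map f xs))) →
      P (take (toℕ j) (List.map f xs)) (List.lookup (List.map f xs) j)
  prefixes-map⁺ P (x ∷ xs) h zero    = h zero
  prefixes-map⁺ P (x ∷ xs) h (suc j) = prefixes-map⁺ (P ∘ (f x ∷_)) xs (h ∘ suc) j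

  prefixes-map⁻ : ∀ {p} (P : List B → B → Set p) xs →
    (∀ (j : Fin (length (List.map f xs))) →
      P (take (toℕ j) (List.map f xs)) (List.lookup (List.map f xs) j)) →
    ∀ (j : Fin (length xs)) → P (List.map f (take (toℕ j) xs)) (f (List.lookup xs j))
  prefixes-map⁻ P (x ∷ xs) h zero    = h zero
  prefixes-map⁻ P (x ∷ xs) h (suc j) = prefixes-map⁻ (P ∘ (f x ∷_)) xs (h ∘ suc) j

  unmap : ∀ {q} {Q : Pred A q} ys → (∀ {y} → y ∈ᴸ ys → ∃[ x ] Q x × f x ≡ y) →
          ∃[ xs ] ys ≡ List.map f xs × (∀ {x} → x ∈ᴸ xs → Q x)
  unmap []       h = [] , ≡.refl , λ ()
  unmap (y ∷ ys) h with h (here ≡.refl) | unmap ys (h ∘ there)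
  ... | x , Qx , ≡.refl | xs , ≡.refl , Qxs =
    x ∷ xs , ≡.refl , λ { (here ≡.refl) → Qx ; (there x∈) → Qxs x∈ }

missing-complete : ∀ {d n} → Missing [] (complete {d} {n})
missing-complete = (λ ()) , λ ∣f∣≡d ¬∣f∣≡d → ⊥-elim (¬∣f∣≡d ∣f∣≡d)

module Proof {c ℓ₁ ℓ₂} (𝕂 : HeytingField c ℓ₁ ℓ₂) (d n : ℕ) (C : Clutter d n) where
  open PolynomialRing 𝕂 n
  open MonomialIdeals 𝕂 n
  open LinearQuotients 𝕂 n
  open BettiNumbers 𝕂 n

  I : Ideal
  I = circuitIdeal (complement C)

  𝐱-∣⇒⊆ : ∀ {f g} → 𝐱 f ∣ᵐ 𝐱 g → f ⊆ g
  𝐱-∣⇒⊆ {f} {g} d i∈f = supp-𝐱⇒ (𝐱∣⇒ d i∈f)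

  𝐱-injective : ∀ {f g} → 𝐱 f ≡ 𝐱 g → f ≡ g
  𝐱-injective {f} {g} eq = ⊆-antisym
    (𝐱-∣⇒⊆ (≡.subst (𝐱 f ∣ᵐ_) eq ∣ᵐ-refl)) (𝐱-∣⇒⊆ (≡.subst (_∣ᵐ 𝐱 f) eq ∣ᵐ-refl))

  ∣ᵐ-antisym : ∀ {k m} → k ∣ᵐ m → m ∣ᵐ k → k ≡ m
  ∣ᵐ-antisym p q = Pointwise.Pointwise-≡⇒≡ (antisym p q)
    where
    antisym : ∀ {n} {k m} → Pointwise _≤_ {n} {n} k m → Pointwise _≤_ m k → Pointwise _≡_ k m
    antisym []       []       = []
    antisym (p ∷ ps) (q ∷ qs) = ℕ.≤-antisym p q ∷ antisym ps qs

  monomialIdeal⇒ : ∀ ms f → monomialIdeal ms f → ⟦ Div ms ⟧ f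
  monomialIdeal⇒ ms f f∈ = ⟦⟧-mono (λ { m (i , d) → lose (∈-lookup i) d }) f (span⇒⟦⟧ (List.lookup ms) f f∈)

  monomialIdeal⇐ : ∀ ms f → ⟦ Div ms ⟧ f → monomialIdeal ms f
  monomialIdeal⇐ ms f f∈ = ⟦⟧⇒span (List.lookup ms)
    (λ m → map′ to from (Div? ms m)) f (⟦⟧-mono (λ m → to) f f∈)
    where
    to : ∀ {m} → Div ms m → Multiples (List.lookup ms) m
    to m∈ = Any.index m∈ , Any.lookup-index m∈
    from : ∀ {m} → Multiples (List.lookup ms) m → Div ms m
    from (i , d) = lose (∈-lookup i) d

  module _ (ms : List Monomial) (u : Monomial) (A : Subset n) where

    private
      J = colon (monomialIdeal ms) (monomial u)
      V = ⟨ (λ ((i , _) : ∃ (_∈ A)) → variable′ i) ⟩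

      colon-⟦⟧⇒ : ∀ f → J f → ⟦ (λ m → Div ms (u *ᵐ m)) ⟧ f
      colon-⟦⟧⇒ f f∈ = colon⇒ u f
        (⟦⟧-cong (f R.* monomial u) (monomial u R.* f) (R.*-comm f (monomial u))
          (monomialIdeal⇒ ms (f R.* monomial u) f∈))

      colon-⟦⟧⇐ : ∀ f → ⟦ (λ m → Div ms (u *ᵐ m)) ⟧ f → J f
      colon-⟦⟧⇐ f f∈ = monomialIdeal⇐ ms (f R.* monomial u)
        (⟦⟧-cong (monomial u R.* f) (f R.* monomial u) (R.*-comm (monomial u) f) (colon⇐ u f f∈))

    generated : ColonVars ms u A → J ≐ V
    generated colon-A =
        (λ {f} f∈ → ⟦⟧⇒span _ (Vars? A) f (⟦⟧-mono (λ m → proj₂ (colon-A m)) f (colon-⟦⟧⇒ f f∈)))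
      , (λ {f} f∈ → colon-⟦⟧⇐ f (⟦⟧-mono (λ m → proj₁ (colon-A m)) f (span⇒⟦⟧ _ f f∈)))

    generated⁻¹ : J ≐ V → ColonVars ms u A
    generated⁻¹ (J⊆V , V⊆J) m =
        (λ m∈ → monomial∈⁻¹ (λ k → Div? ms (u *ᵐ k))
           (colon-⟦⟧⇒ (monomial m) (V⊆J {monomial m} (⟦⟧⇒span _ (Vars? A) (monomial m) (monomial∈ m∈)))))
      , (λ m∈ → monomial∈⁻¹ (Vars? A)
           (span⇒⟦⟧ _ (monomial m) (J⊆V {monomial m} (colon-⟦⟧⇐ (monomial m) (monomial∈ m∈)))))

  -- Two test monomials suffice. The product of 𝐱 e and 𝐱 (f ─ e) is a multiple of 𝐱 f, so some
  -- variable of f ─ e lies in A. A variable i in A times 𝐱 e is a multiple of some 𝐱 f, so f ⊆ e ∪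
  -- ⁅ i ⁆.
  colonVars⇒separates : ∀ xs e A → ColonVars (List.map 𝐱 xs) (𝐱 e) A → Separates xs e A
  colonVars⇒separates xs e A colon-A = meets , generates
    where
    meets : ∀ {f} → f ∈ᴸ xs → ∃[ i ] i ∈ A × i ∈ f × i ∉ e
    meets {f} f∈xs =
      let (i , i∈A , p) = vars⁻¹ (proj₂ (colon-A (𝐱 (f ─ e))) (lose (∈-map⁺ 𝐱 f∈xs) (𝐱∣⇐ divides)))
          i∈f─e = supp-𝐱⇒ p
      in i , i∈A , p─q⊆p f e i∈f─e , x∈p─q⇒x∉q f e i∈f─e
      where
      divides : ∀ {j} → j ∈ f → Supp (𝐱 e *ᵐ 𝐱 (f ─ e)) j
      divides {j} j∈f with j ∈? e
      ... | yes j∈e = supp-*⇐ˡ {𝐱 e} {𝐱 (f ─ e)} (supp-𝐱⇐ j∈e)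
      ... | no  j∉e = supp-*⇐ʳ {𝐱 e} {𝐱 (f ─ e)} (supp-𝐱⇐ (x∈p∧x∉q⇒x∈p─q j∈f j∉e))
    generates : ∀ {i} → i ∈ A → ∃[ f ] f ∈ᴸ xs × f ⊆ e ∪ ⁅ i ⁆
    generates {i} i∈A with find (Any.map⁻ (proj₁ (colon-A (𝐱 ⁅ i ⁆)) (vars i∈A (supp-𝐱⇐ (x∈⁅x⁆ i)))))
    ... | f , f∈xs , divides = f , f∈xs , λ j∈f →
      x∈p∪q⁺ (Sum.map supp-𝐱⇒ supp-𝐱⇒ (supp-*⇒ {𝐱 e} {𝐱 ⁅ i ⁆} (𝐱∣⇒ divides j∈f)))

  separates⇒colonVars : ∀ xs e A → Separates xs e A → ColonVars (List.map 𝐱 xs) (𝐱 e) A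
  separates⇒colonVars xs e A (meets , generates) m = to , from
    where
    to : Vars A m → Div (List.map 𝐱 xs) (𝐱 e *ᵐ m)
    to m∈ with vars⁻¹ m∈
    ... | i , i∈A , p with generates i∈A
    ...   | f , f∈xs , f⊆ = lose (∈-map⁺ 𝐱 f∈xs) (𝐱∣⇐ λ j∈f →
      Sum.[ (λ j∈e → supp-*⇐ˡ {𝐱 e} {m} (supp-𝐱⇐ j∈e))
          , (λ j∈i → supp-*⇐ʳ {𝐱 e} {m} (≡.subst (Supp m) (≡.sym (x∈⁅y⁆⇒x≡y i j∈i)) p))
          ]′ (x∈p∪q⁻ e ⁅ i ⁆ (f⊆ j∈f)))
    from : Div (List.map 𝐱 xs) (𝐱 e *ᵐ m) → Vars A m
    from m∈ with find (Any.map⁻ m∈)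
    ... | f , f∈xs , divides with meets f∈xs
    ...   | i , i∈A , i∈f , i∉e with supp-*⇒ {𝐱 e} {m} (𝐱∣⇒ divides i∈f)
    ...     | inj₁ p = ⊥-elim (i∉e (supp-𝐱⇒ p))
    ...     | inj₂ p = vars i∈A p

  circuits : ∃ (Circuit (complement C)) → Monomial
  circuits (f , _) = 𝐱 f

  circuits? : Decidable (Multiples circuits)
  circuits? m = map′ (λ (f , f∈ , divides) → (f , f∈) , divides) (λ ((f , f∈) , divides) → f , f∈ , divides)
    (anySubset? (λ f → circuit? (complement C) f ×-dec (𝐱 f ∣ᵐ? m)))

  module _ {ys : List (Subset n)} (missing : Missing ys C) where

    private
      ms = List.map 𝐱 ys

      to : ∀ {m} → Div ms m → Multiples circuits m
      to m∈ with find (Any.map⁻ m∈)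
      ... | f , f∈ys , divides = (f , proj₁ missing f∈ys) , divides

      from : ∀ {m} → Multiples circuits m → Div ms m
      from ((f , ∣f∣≡d , f∉C) , divides) = lose (∈-map⁺ 𝐱 (proj₂ missing ∣f∣≡d f∉C)) divides

    circuitIdeal⇒ : ∀ f → I f → ⟦ Div ms ⟧ f
    circuitIdeal⇒ f f∈ = ⟦⟧-mono (λ m → from) f (span⇒⟦⟧ circuits f f∈)

    circuitIdeal⇐ : ∀ f → ⟦ Div ms ⟧ f → I f
    circuitIdeal⇐ f f∈ = ⟦⟧⇒span circuits circuits? f (⟦⟧-mono (λ m → to) f f∈)

    degree-generator : ∀ j → degree (List.lookup ms j) ≡ d
    degree-generator j with ∈-map⁻ 𝐱 (∈-lookup {xs = ms} j)
    ... | f , f∈ys , eq = ≡.trans (≡.cong degree eq) (≡.trans (degree-𝐱 f) (proj₁ (proj₁ missing f∈ys)))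

    resolution : (A : Fin (length ms) → Subset n) →
      (∀ j → ColonVars (take (toℕ j) ms) (List.lookup ms j) (A j)) →
      ∃[ r ] Resolved d ms r × (∀ i → r i ≡ 0 → ∀ j → ∣ A j ∣ < i) × (∀ i → (∀ j → ∣ A j ∣ < i) → r i ≡ 0)
    resolution = linear-quotients-resolution ms degree-generator

  private
    +-cancel : ∀ i j k → i ℤ.+ j ≡ + 0 → (k ℤ.+ i) ℤ.+ j ≡ k
    +-cancel i j k i+j≡0 = ≡.trans (ℤ.+-assoc k i j) (≡.trans (≡.cong (λ z → k ℤ.+ z) i+j≡0) (ℤ.+-identityʳ k))

    -- The bound n - d is an integer, as it is negative when d exceeds n; the counting arguments use
    -- m + d < n in ℕ.
    +<⇒<- : ∀ {m} → m + d < n → + m ℤ.< + n ℤ.- + d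
    +<⇒<- {m} m+d<n = ≡.subst (ℤ._< + n ℤ.- + d) (+-cancel (+ d) (ℤ.- + d) (+ m) (ℤ.+-inverseʳ (+ d)))
      (ℤ.+-monoˡ-< (ℤ.- + d) (ℤ.+<+ m+d<n))

    <-⇒+< : ∀ {m} → + m ℤ.< + n ℤ.- + d → m + d < n
    <-⇒+< {m} m<n-d = ℤ.drop‿+<+ (≡.subst (+ (m + d) ℤ.<_)
      (+-cancel (ℤ.- + d) (+ d) (+ n) (ℤ.+-inverseˡ (+ d))) (ℤ.+-monoˡ-< (+ d) m<n-d))

  SmallColon : List Monomial → Monomial → Set
  SmallColon ms u = ∃[ A ] ColonVars ms u A × ∣ A ∣ + d < n

  pdim-bound : ∀ ys → Missing ys C →
    (∀ (j : Fin (length (List.map 𝐱 ys))) →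
      SmallColon (take (toℕ j) (List.map 𝐱 ys)) (List.lookup (List.map 𝐱 ys) j)) →
    ∃[ p ] IsPdim I p × p <₋ [ + n ℤ.- + d ]
  -- The ideal is 0 here, and -∞ lies below n - d even when that is not positive.
  pdim-bound [] missing _ = ⊥₋ , pdim-zero (λ f f∈ m → circuitIdeal⇒ missing f f∈ m λ ()) , ⊥₋<[ _ ]
  pdim-bound (y ∷ ys) missing small =
    let (j₀ , max) = argmax (∣_∣ ∘ A)
        (r , F , r≡0⇒ , ⇒r≡0) = resolution missing A (λ j → proj₁ (proj₂ (small j)))
    in [ + ∣ A j₀ ∣ ]
     , pdim F (circuitIdeal⇒ missing) (circuitIdeal⇐ missing) ∣ A j₀ ∣
         (λ r≡0 → ℕ.<-irrefl ≡.refl (r≡0⇒ _ r≡0 j₀))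
         (λ i A<i → ⇒r≡0 i (λ j → ℕ.≤-<-trans (max j) A<i))
     , [ +<⇒<- (proj₂ (proj₂ (small j₀))) ]
    where
    A : Fin (length (List.map 𝐱 (y ∷ ys))) → Subset n
    A j = proj₁ (small j)

  linear⇒quotients : ∀ ys → Missing ys C → Unique ys →
    (∀ (j : Fin (length ys)) → LinearStep (take (toℕ j) ys) (List.lookup ys j)) →
    HasLinearQuotients I × ∃[ p ] IsPdim I p × p <₋ [ + n ℤ.- + d ]
  linear⇒quotients ys missing unique linear =
      (ms , record { generate = generate ; minimal = minimal ; distinct = Unique.map⁺ 𝐱-injective unique }
          , λ j _ → proj₁ (small j) , generated _ _ (proj₁ (small j)) (proj₁ (proj₂ (small j))))
    , pdim-bound ys missing small
    where
    ms = List.map 𝐱 ys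
    small : ∀ (j : Fin (length ms)) → SmallColon (take (toℕ j) ms) (List.lookup ms j)
    small = prefixes-map⁺ 𝐱 SmallColon ys λ j →
      let (A , separates , size) = linear j in A , separates⇒colonVars _ _ A separates , size
    generate : I ≐ monomialIdeal ms
    generate = (λ {f} f∈ → monomialIdeal⇐ ms f (circuitIdeal⇒ missing f f∈))
             , (λ {f} f∈ → circuitIdeal⇐ missing f (monomialIdeal⇒ ms f f∈))
    -- A generator 𝐱 g dividing k divides m = 𝐱 f too, and g ⊆ f have equal size. So g = f, and k
    -- lies between m and m.
    antichain : ∀ {m k} → m ∈ᴸ ms → Div ms k → k ∣ᵐ m → k ≡ m
    antichain {k = k} m∈ k∈ k∣m with ∈-map⁻ 𝐱 m∈ | find (Any.map⁻ k∈)
    ... | f , f∈ys , ≡.refl | g , g∈ys , g∣k = ∣ᵐ-antisym k∣m (≡.subst (λ h → 𝐱 h ∣ᵐ k) g≡f g∣k)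
      where
      g≡f : g ≡ f
      g≡f = ⊆∧∣∣≡⇒≡ (𝐱-∣⇒⊆ (∣ᵐ-trans g∣k k∣m))
        (≡.trans (proj₁ (proj₁ missing g∈ys)) (≡.sym (proj₁ (proj₁ missing f∈ys))))
    minimal : ∀ {m} → m ∈ᴸ ms → ∀ k → I (monomial k) → k ∣ᵐ m → k ≡ m
    minimal m∈ k k∈ = antichain m∈ (monomial∈⁻¹ (Div? ms) (circuitIdeal⇒ missing (monomial k) k∈))

  circuit∈I : ∀ f → ∣ f ∣ ≡ d → ¬ Circuit C f → I (monomial (𝐱 f))
  circuit∈I f ∣f∣≡d f∉C =
    ⟦⟧⇒span circuits circuits? (monomial (𝐱 f)) (monomial∈ ((f , ∣f∣≡d , f∉C) , ∣ᵐ-refl))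

  module _ {ms} (generators : MinimalMonomialGenerators I ms) where
    open MinimalMonomialGenerators generators

    -- As an element of I, m is a multiple of some 𝐱 f with f missing; minimality of m forces
    -- equality.
    generator-𝐱 : ∀ {m} → m ∈ᴸ ms → ∃[ f ] (∣ f ∣ ≡ d × ¬ Circuit C f) × 𝐱 f ≡ m
    generator-𝐱 {m} m∈ =
      let m∈I = proj₂ generate {monomial m} (monomialIdeal⇐ ms (monomial m) (monomial∈ (lose m∈ ∣ᵐ-refl)))
          ((f , ∣f∣≡d , f∉C) , divides) = monomial∈⁻¹ circuits? (span⇒⟦⟧ circuits (monomial m) m∈I)
      in f , (∣f∣≡d , f∉C) , minimal m∈ (𝐱 f) (circuit∈I f ∣f∣≡d f∉C) divides

    -- No missing f is left out: 𝐱 f is a multiple of some generator 𝐱 g, and equal sizes give g =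
    -- f.
    generators-missing : ∀ {ys} → ms ≡ List.map 𝐱 ys → (∀ {f} → f ∈ᴸ ys → ∣ f ∣ ≡ d × ¬ Circuit C f) → Missing ys C
    generators-missing {ys} ms≡ sound = sound , all
      where
      all : ∀ {f} → ∣ f ∣ ≡ d → ¬ Circuit C f → f ∈ᴸ ys
      all {f} ∣f∣≡d f∉C =
        let f∈ms = monomialIdeal⇒ ms (monomial (𝐱 f)) (proj₁ generate {monomial (𝐱 f)} (circuit∈I f ∣f∣≡d f∉C))
            (g , g∈ys , divides) = find (Any.map⁻ (≡.subst (λ l → Div l (𝐱 f)) ms≡ (monomial∈⁻¹ (Div? ms) f∈ms)))
        in ≡.subst (_∈ᴸ ys) (⊆∧∣∣≡⇒≡ (𝐱-∣⇒⊆ divides) (≡.trans (proj₁ (sound g∈ys)) (≡.sym ∣f∣≡d))) g∈ys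

  LinearColons : List Monomial → Set _
  LinearColons ms = ∀ (j : Fin (length ms)) → 1 ≤ toℕ j →
    GeneratedByVariables (colon (monomialIdeal (take (toℕ j) ms)) (monomial (List.lookup ms j)))

  colons : ∀ ms →
    LinearColons ms →
    ∀ j → ∃[ A ] ColonVars (take (toℕ j) ms) (List.lookup ms j) A
  -- Linear quotients constrain the colon ideals from the second generator on. The first one is the
  -- zero ideal, so A is empty; its size 0 later yields d < n.
  colons (m ∷ ms) quotients zero    = ⊥ , λ k → (λ { ((i , i∈⊥) , _) → ⊥-elim (∉⊥ i∈⊥) }) , λ ()
  colons (m ∷ ms) quotients (suc j) =
    let (A , eq) = quotients (suc j) (s≤s z≤n) in A , generated⁻¹ _ _ A eq

  module _ {ys : List (Subset n)} (missing : Missing ys C) where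

    private
      ms = List.map 𝐱 ys

    -- The resolution has nonzero rank in degree ∣ A j ∣, so this degree is at most the projective
    -- dimension. In the case of the zero ideal, the generator with index j would be 0.
    colon-size : (A : Fin (length ms) → Subset n) →
      (∀ j → ColonVars (take (toℕ j) ms) (List.lookup ms j) (A j)) →
      ∀ {p} → IsPdim I p → p <₋ [ + n ℤ.- + d ] → ∀ j → ∣ A j ∣ + d < n
    colon-size A colon-A (pdim-zero I≈0) _ j =
      ⊥-elim (1≉0 (K.trans (K.sym (coeff-monomial-≡ {m} ≡.refl)) (I≈0 (monomial m) m∈I m)))
      where
      m = List.lookup ms j
      m∈I : I (monomial m)
      m∈I = circuitIdeal⇐ missing (monomial m) (monomial∈ (lose (∈-lookup j) ∣ᵐ-refl))
    colon-size A colon-A (pdim-max i _ bound) [ i<n-d ] j =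
      let (r , F , r≡0⇒ , _) = resolution missing A colon-A
      in ℕ.≤-<-trans
           (ℕ.+-monoˡ-≤ d (bound ∣ A j ∣ (betti-nonzero F (circuitIdeal⇒ missing) (circuitIdeal⇐ missing) ∣ A j ∣
             (λ r≡0 → ℕ.<-irrefl ≡.refl (r≡0⇒ _ r≡0 j)))))
           (<-⇒+< i<n-d)

    quotients⇒linear :
      LinearColons ms →
      ∀ {p} → IsPdim I p → p <₋ [ + n ℤ.- + d ] →
      ∀ (j : Fin (length ys)) → LinearStep (take (toℕ j) ys) (List.lookup ys j)
    quotients⇒linear quotients is-pdim p< j =
      let (A , colon-A , size) = prefixes-map⁻ 𝐱 SmallColon ys small j
      in A , colonVars⇒separates _ _ A colon-A , size
      where
      colon-A = colons ms quotients
      small : ∀ j → SmallColon (take (toℕ j) ms) (List.lookup ms j)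
      small j = proj₁ (colon-A j) , proj₂ (colon-A j)
              , colon-size (proj₁ ∘ colon-A) (proj₂ ∘ colon-A) is-pdim p< j

    linear⇒obtained : 1 ≤ d →
      (∀ (j : Fin (length ys)) → LinearStep (take (toℕ j) ys) (List.lookup ys j)) → ObtainedByErasures C
    linear⇒obtained 1≤d linear =
      let (D , steps , (sound , all)) = linear⇒erasures 1≤d complete [] ys missing-complete
                                          (proj₁ ∘ proj₁ missing) linear
      in D , steps
       , (λ {f} f∈D → decidable-stable (circuit? C f) λ f∉C →
            proj₂ (sound (proj₂ missing (uniform D f∈D) f∉C)) f∈D)
       , (λ {f} f∈C → decidable-stable (circuit? D f) λ f∉D →
            proj₂ (proj₁ missing (all (uniform C f∈C) f∉D)) f∈C)

  forward : 1 ≤ d → ObtainedByErasures C → HasLinearQuotients I × ∃[ p ] IsPdim I p × p <₋ [ + n ℤ.- + d ]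
  forward 1≤d (D , steps , D⊆C , C⊆D) =
    let (ys , (sound , all) , unique , linear) = erasures⇒linear 1≤d steps [] missing-complete []
    in linear⇒quotients ys
         ( (λ f∈ys → proj₁ (sound f∈ys) , proj₂ (sound f∈ys) ∘ C⊆D)
         , (λ ∣f∣≡d f∉C → all ∣f∣≡d (f∉C ∘ D⊆C)))
         unique linear

  backward : 1 ≤ d → HasLinearQuotients I × ∃[ p ] IsPdim I p × p <₋ [ + n ℤ.- + d ] → ObtainedByErasures C
  backward 1≤d ((ms , generators , quotients) , p , is-pdim , p<) =
    finish (unmap 𝐱 ms (generator-𝐱 generators))
    where
    finish : (∃[ ys ] ms ≡ List.map 𝐱 ys × (∀ {f} → f ∈ᴸ ys → ∣ f ∣ ≡ d × ¬ Circuit C f)) → ObtainedByErasures C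
    finish (ys , ms≡ , sound) = linear⇒obtained missing 1≤d
        (quotients⇒linear missing (≡.subst LinearColons ms≡ quotients) is-pdim p<)
      where
      missing = generators-missing generators ms≡ sound

proposition3p7 : ∀ {c ℓ₁ ℓ₂} (K : HeytingField c ℓ₁ ℓ₂) (d n : ℕ) → 1 ≤ d →
    (C : Clutter d n) →
    let open OverField.Polynomials K n
        I = circuitIdeal (complement C)
    in
    ObtainedByErasures C ⇔
      (HasLinearQuotients I ×
       (∃[ p ] IsPdim I p × p <₋ [ + n ℤ.- + d ]))
proposition3p7 K d n 1≤d C = mk⇔ (forward 1≤d) (backward 1≤d)
  where open Proof K d n C
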